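{- For any nonempty $\Pi^0_1$ sets $P,Q\subseteq2^{\mathbb N}$, $Q^\frown P$ does not $(1,1)$-cup to $P$; that is to say, for any $R\subseteq\mathbb N^{\mathbb N}$, if $P\le^1_1(Q^\frown P)\otimes R$ then $P\le^1_1R$.
   Context: For $A,B\subseteq\mathbb N^{\mathbb N}$, $A\le^1_1B$ (Medvedev reducibility) means that there is a partial computable function $\Gamma:\subseteq\mathbb N^{\mathbb N}\to\mathbb N^{\mathbb N}$ defined on all of $B$ with $\Gamma(g)\in A$ for every $g\in B$. For $f,g\in\mathbb N^{\mathbb N}$, $(f\oplus g)(2n)=f(n)$ and $(f\oplus g)(2n+1)=g(n)$; and $A\otimes B=\{f\oplus g:f\in A,\ g\in B\}$. With each $\Pi^0_1$ set $Q\subseteq2^{\mathbb N}$ (given by an index) a corresponding computable tree $T_Q\subseteq2^{<\mathbb N}$ whose set of infinite paths is $Q$ is fixed; $L_Q$ is the set of leaves (dead ends) of $T_Q$, i.e. strings in $T_Q$ with no proper extension in $T_Q$. The concatenation of $Q$ and $P$ is $Q^\frown P=Q\cup\bigcup_{\rho\in L_Q}\rho^\frown P$, where $\rho^\frown P=\{\rho^\frown f:f\in P\}$. -}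

module Defs where

open import Data.Fin.Base using (Fin; toℕ)
open import Data.List.Base using (List; []; _∷_; _++_; applyUpTo)
open import Data.Nat.Base using (ℕ; zero; suc; _+_; _*_; _<_)
open import Data.Nat.Properties using (+-suc)
open import Data.Product.Base using (Σ-syntax; ∃-syntax; _×_)
open import Data.Sum.Base using (_⊎_)
open import Data.Vec.Base as Vec using (Vec; []; _∷_)
open import Data.Vec.Relation.Binary.Pointwise.Inductive using (Pointwise)
open import Function.Base using (_∘_)
open import Level using (Level; 0ℓ; _⊔_)
open import Relation.Binary.PropositionalEquality using (_≡_; refl; trans; cong; _≗_)
open import Relation.Nullary.Negation.Core using (¬_)
open import Relation.Unary using (Pred; _∈_; _∉_; _≐_)

private
  variable
    a b : Level
    k m n : ℕ

Baire : Set
Baire = ℕ → ℕ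

Cantor : Set
Cantor = ℕ → Fin 2

String : Set
String = List (Fin 2)

-- Kleene's partial recursive functionals of k function arguments (the
-- oracles) and n number arguments; k = 0 gives the partial recursive
-- functions.

data Code (k : ℕ) : ℕ → Set where
  zeroᶜ   : Code k n
  sucᶜ    : Code k 1
  proj    : Fin n → Code k n
  oracle  : Fin k → Code k 1
  comp    : Code k m → Vec (Code k n) m → Code k n
  primrec : Code k n → Code k (2 + n) → Code k (suc n)
  μ       : Code k (suc n) → Code k n

infix 4 _⊢_·_⇓_

-- gs ⊢ c · xs ⇓ y : the functional c, applied to the functions gs and
-- the numbers xs, is defined with value y.

data _⊢_·_⇓_ (gs : Vec Baire k) : Code k n → Vec ℕ n → ℕ → Set where
  zero⇓   : {xs : Vec ℕ n} → gs ⊢ zeroᶜ · xs ⇓ 0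
  suc⇓    : ∀ {x} → gs ⊢ sucᶜ · x ∷ [] ⇓ suc x
  proj⇓   : {i : Fin n} {xs : Vec ℕ n} → gs ⊢ proj i · xs ⇓ Vec.lookup xs i
  oracle⇓ : ∀ {i x} → gs ⊢ oracle i · x ∷ [] ⇓ Vec.lookup gs i x
  comp⇓   : {c : Code k m} {ds : Vec (Code k n) m} {xs : Vec ℕ n} {ys : Vec ℕ m} →
            ∀ {z} →
            Pointwise (λ d y → gs ⊢ d · xs ⇓ y) ds ys →
            gs ⊢ c · ys ⇓ z →
            gs ⊢ comp c ds · xs ⇓ z
  base⇓   : {c : Code k n} {d : Code k (2 + n)} {xs : Vec ℕ n} → ∀ {y} →
            gs ⊢ c · xs ⇓ y →
            gs ⊢ primrec c d · 0 ∷ xs ⇓ y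
  step⇓   : {c : Code k n} {d : Code k (2 + n)} {xs : Vec ℕ n} → ∀ {x y z} →
            gs ⊢ primrec c d · x ∷ xs ⇓ y →
            gs ⊢ d · x ∷ y ∷ xs ⇓ z →
            gs ⊢ primrec c d · suc x ∷ xs ⇓ z
  μ⇓      : {c : Code k (suc n)} {xs : Vec ℕ n} → ∀ {x} →
            gs ⊢ c · x ∷ xs ⇓ 0 →
            (∀ {w} → w < x → ∃[ v ] gs ⊢ c · w ∷ xs ⇓ suc v) →
            gs ⊢ μ c · xs ⇓ x

-- The partial computable function Γ :⊆ ℕ^ℕ → ℕ^ℕ is defined at g iff
-- n ↦ Γ(g)(n) is total, and then its value is that function.

Functional : Set
Functional = Code 1 1

infix 4 _[_]≈_

_[_]≈_ : Functional → Baire → Baire → Set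
Γ [ g ]≈ f = ∀ n → (g ∷ []) ⊢ Γ · n ∷ [] ⇓ f n

infix 4 _≤¹₁_

_≤¹₁_ : Pred Baire a → Pred Baire b → Set (a ⊔ b)
A ≤¹₁ B = Σ[ Γ ∈ Functional ] ∀ {g} → g ∈ B → ∃[ f ] f ∈ A × Γ [ g ]≈ f

_⊕_ : Baire → Baire → Baire
(f ⊕ g) zero    = f zero
(f ⊕ g) (suc n) = (g ⊕ (f ∘ suc)) n

⊕-even : ∀ f g n → (f ⊕ g) (2 * n) ≡ f n
⊕-even f g zero    = refl
⊕-even f g (suc n) =
  trans (cong (g ⊕ (f ∘ suc)) (+-suc n (n + 0))) (⊕-even (f ∘ suc) (g ∘ suc) n)

⊕-odd : ∀ f g n → (f ⊕ g) (suc (2 * n)) ≡ g n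
⊕-odd f g n = ⊕-even g (f ∘ suc) n

-- Without function extensionality, sets given by a comprehension
-- {F x : x ∈ A} are taken up to pointwise equality.

infixr 7 _⊗_

_⊗_ : Pred Baire a → Pred Baire b → Pred Baire (a ⊔ b)
(A ⊗ B) h = ∃[ f ] ∃[ g ] f ∈ A × g ∈ B × h ≗ f ⊕ g

-- A subset of 2^ℕ regarded as a subset of ℕ^ℕ.

⌊_⌋ : Pred Cantor a → Pred Baire a
⌊ A ⌋ f = ∃[ X ] X ∈ A × f ≗ toℕ ∘ X

-- The Π⁰₁ set with index e is {X : Φ_e(X)(0)↑}.

Π⁰₁-set : Functional → Pred Cantor 0ℓ
Π⁰₁-set e X = ¬ (∃[ y ] ((toℕ ∘ X) ∷ []) ⊢ e · 0 ∷ [] ⇓ y)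

IsΠ⁰₁ : Pred Cantor 0ℓ → Set
IsΠ⁰₁ A = Σ[ e ∈ Functional ] A ≐ Π⁰₁-set e

-- Bijective base-2 numeration, least significant digit first.

⌜_⌝ : String → ℕ
⌜ [] ⌝    = 0
⌜ i ∷ σ ⌝ = suc (toℕ i + 2 * ⌜ σ ⌝)

Computable : Pred String 0ℓ → Set
Computable S = Σ[ c ∈ Code 0 1 ] ∀ σ →
  (σ ∈ S × ([] ⊢ c · ⌜ σ ⌝ ∷ [] ⇓ 1)) ⊎ (σ ∉ S × ([] ⊢ c · ⌜ σ ⌝ ∷ [] ⇓ 0))

IsTree : Pred String 0ℓ → Set
IsTree T = ∀ σ τ → σ ++ τ ∈ T → σ ∈ T

Paths : Pred String 0ℓ → Pred Cantor 0ℓ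
Paths T X = ∀ n → applyUpTo X n ∈ T

Leaf : Pred String 0ℓ → Pred String 0ℓ
Leaf T σ = σ ∈ T × (∀ τ → σ ++ τ ∈ T → τ ≡ [])

record IsCorrespondingTree (T : Pred String 0ℓ) (Q : Pred Cantor 0ℓ) : Set where
  field
    isTree     : IsTree T
    computable : Computable T
    paths      : Paths T ≐ Q

infixr 5 _⌢_

_⌢_ : String → Cantor → Cantor
([]      ⌢ X) n       = X n
((i ∷ σ) ⌢ X) zero    = i
((i ∷ σ) ⌢ X) (suc n) = (σ ⌢ X) n

_⌢ˢ_ : String → Pred Cantor 0ℓ → Pred Cantor 0ℓ
(ρ ⌢ˢ P) X = ∃[ Y ] Y ∈ P × X ≗ ρ ⌢ Y

-- Q ⌢[ T ] P is the concatenation of Q and P, with T in the role of the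
-- tree T_Q fixed for Q.

_⌢[_]_ : Pred Cantor 0ℓ → Pred String 0ℓ → Pred Cantor 0ℓ → Pred Cantor 0ℓ
(Q ⌢[ T ] P) X = X ∈ Q ⊎ (∃[ ρ ] ρ ∈ Leaf T × X ∈ ρ ⌢ˢ P)

{-# OPTIONS --safe #-}

-- Let Φ witness P ≤ (Q ⌢ P) ⊗ R, and let g ∈ R. If some σ ∈ T has no leaf above
-- it, then the leftmost path of T through σ is a computable element X of Q, and
-- Φ(X ⊕ g) ∈ P. Otherwise write F_ρ(Y) = Φ((ρ ⌢ Y) ⊕ g), which maps P to P for
-- every leaf ρ, and choose leaves ρ₀, ρ₁, … in turn such that the finite string
-- F_ρ₀(F_ρ₁(…F_ρₙ([])…)) has a bit at position n. Such ρₙ exists close to any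
-- element X of Q, since F_ρ₀(…F_ρₙ₋₁(Φ(X ⊕ g))…) is total. These strings are
-- compatible initial segments of elements of P, so their limit, computed from
-- g, lies in P.

module Submission where

open import Defs
open import Axiom.ExcludedMiddle using (ExcludedMiddle)
open import Data.Empty using (⊥-elim)
open import Data.Fin.Base using (Fin; toℕ; _↑ʳ_)
open import Data.Fin.Properties using (toℕ-injective)
open import Data.Fin.Patterns using (0F; 1F; 2F; 3F)
open import Data.List.Base as List using (List; []; _∷_; _++_; applyUpTo; upTo; foldr; replicate)
open import Data.List.Properties using (foldr-++; foldr-map; ++-assoc; ++-identityʳ; ++-is-foldr; applyUpTo-∷ʳ)
open import Data.Nat.Base
open import Data.Nat.Properties
open import Data.Product.Base using (Σ-syntax; ∃-syntax; _×_; _,_; proj₁; proj₂)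
open import Data.Sum.Base using (_⊎_; inj₁; inj₂; [_,_]′)
open import Data.Vec.Base as Vec using (Vec; []; _∷_)
open import Data.Vec.Relation.Binary.Pointwise.Inductive using (Pointwise; []; _∷_)
open import Function.Base using (_∘_; id)
open import Level using (Level; 0ℓ)
open import Relation.Binary.PropositionalEquality
open import Relation.Nullary using (¬_; Dec; yes; no)
open import Relation.Nullary.Decidable using (decidable-stable)
open import Relation.Unary using (Pred; Satisfiable; _∈_; _∉_)

-- An element X of Q gives Φ(X ⊕ g) in P, but X need not be computable from g, and different leaves
-- may give incompatible values. Nesting removes the conflict: by monotonicity a bit of
-- F_ρ₀(...F_ρₙ([])...) is a bit of F_ρ₀(...F_ρₙ(Y)...) for every Y in P, and whatever is later put
-- in place of Y again lies in P. The composite grows with n, so it is handled as data: a word,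
-- stored as a number, which a bounded evaluator interprets. The value of Φ on a finite input may
-- have gaps, so the evaluator works with finite partial functions instead of strings. Base 4 suits
-- both: 0 for undefined, 1 and 2 for the bits, and 3, as a letter of a word, for an application of
-- Φ.

private
  variable
    a : Level
    A : Set a
    k l m n : ℕ

-- Computable functionals

-- Used twice: with k = 0 to view the oracle-free decision procedure of the tree as a code with an
-- oracle, and with k = 1 to feed Φ an oracle that is itself computed from g.
sub  : (Fin k → Code l 1) → Code k n → Code l n
subs : (Fin k → Code l 1) → Vec (Code k n) m → Vec (Code l n) m

sub θ zeroᶜ         = zeroᶜ
sub θ sucᶜ          = sucᶜ
sub θ (proj i)      = proj i
sub θ (oracle i)    = θ i
sub θ (comp c ds)   = comp (sub θ c) (subs θ ds)
sub θ (primrec c d) = primrec (sub θ c) (sub θ d)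
sub θ (μ c)         = μ (sub θ c)

subs θ []       = []
subs θ (d ∷ ds) = sub θ d ∷ subs θ ds

module _ {gs : Vec Baire k} {hs : Vec Baire l} {θ : Fin k → Code l 1}
         (θ⇓ : ∀ i x → hs ⊢ θ i · x ∷ [] ⇓ Vec.lookup gs i x) where

  sub⇓  : ∀ {c : Code k n} {xs y} → gs ⊢ c · xs ⇓ y → hs ⊢ sub θ c · xs ⇓ y
  subs⇓ : ∀ {ds : Vec (Code k n) m} {xs ys} →
          Pointwise (λ d y → gs ⊢ d · xs ⇓ y) ds ys →
          Pointwise (λ d y → hs ⊢ d · xs ⇓ y) (subs θ ds) ys

  sub⇓ zero⇓             = zero⇓
  sub⇓ suc⇓              = suc⇓
  sub⇓ proj⇓             = proj⇓
  sub⇓ (oracle⇓ {i} {x}) = θ⇓ i x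
  sub⇓ (comp⇓ ps p)      = comp⇓ (subs⇓ ps) (sub⇓ p)
  sub⇓ (base⇓ p)         = base⇓ (sub⇓ p)
  sub⇓ (step⇓ p q)       = step⇓ (sub⇓ p) (sub⇓ q)
  sub⇓ (μ⇓ p ps)         = μ⇓ (sub⇓ p) (λ w<x → proj₁ (ps w<x) , sub⇓ (proj₂ (ps w<x)))

  subs⇓ []       = []
  subs⇓ (p ∷ ps) = sub⇓ p ∷ subs⇓ ps

natrec : A → (ℕ → A → A) → ℕ → A
natrec z s zero    = z
natrec z s (suc n) = s n (natrec z s n)

record Total (n : ℕ) : Set where
  field
    fun   : Baire → Vec ℕ n → ℕ
    code  : Code 1 n
    code⇓ : ∀ g xs → g ∷ [] ⊢ code · xs ⇓ fun g xs

record Totals (m n : ℕ) : Set where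
  field
    fun    : Baire → Vec ℕ n → Vec ℕ m
    codes  : Vec (Code 1 n) m
    codes⇓ : ∀ g xs → Pointwise (λ d y → g ∷ [] ⊢ d · xs ⇓ y) codes (fun g xs)

open Total
open Totals using (codes; codes⇓)

-- Keeps the code but replaces the function it was assembled from by a readable one, so that later
-- proofs never meet the primitive recursions underneath.
reshape : (t : Total n) (F : Baire → Vec ℕ n → ℕ) → (∀ g xs → fun t g xs ≡ F g xs) → Total n
reshape t F eq = record
  { fun = F ; code = code t
  ; code⇓ = λ g xs → subst (g ∷ [] ⊢ code t · xs ⇓_) (eq g xs) (code⇓ t g xs) }

reshapes : (ts : Totals m n) (F : Baire → Vec ℕ n → Vec ℕ m) →
           (∀ g xs → Totals.fun ts g xs ≡ F g xs) → Totals m n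
reshapes ts F eq = record
  { fun = F ; codes = codes ts
  ; codes⇓ = λ g xs → subst (Pointwise _ (codes ts)) (eq g xs) (codes⇓ ts g xs) }

[]ᵗ : Totals 0 n
[]ᵗ = record { fun = λ _ _ → [] ; codes = [] ; codes⇓ = λ _ _ → [] }

infixr 5 _∷ᵗ_

_∷ᵗ_ : Total n → Totals m n → Totals (suc m) n
t ∷ᵗ ts = record
  { fun    = λ g xs → fun t g xs ∷ Totals.fun ts g xs
  ; codes  = code t ∷ codes ts
  ; codes⇓ = λ g xs → code⇓ t g xs ∷ codes⇓ ts g xs }

dropᵛ : ∀ k → Vec ℕ (k + n) → Vec ℕ n
dropᵛ zero    xs       = xs
dropᵛ (suc k) (_ ∷ xs) = dropᵛ k xs

lookup-dropᵛ : ∀ k (xs : Vec ℕ (k + n)) i → Vec.lookup xs (k ↑ʳ i) ≡ Vec.lookup (dropᵛ k xs) i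
lookup-dropᵛ zero    xs       i = refl
lookup-dropᵛ (suc k) (_ ∷ xs) i = lookup-dropᵛ k xs i

projs⇓ : ∀ {gs : Vec Baire k} {xs : Vec ℕ n} (f : Fin m → Fin n) (ys : Vec ℕ m) →
         (∀ i → Vec.lookup xs (f i) ≡ Vec.lookup ys i) →
         Pointwise (λ d y → gs ⊢ d · xs ⇓ y) (Vec.tabulate (proj ∘ f)) ys
projs⇓ f []       eq = []
projs⇓ {gs = gs} {xs} f (y ∷ ys) eq =
  subst (gs ⊢ proj (f Fin.zero) · xs ⇓_) (eq Fin.zero) proj⇓ ∷
  projs⇓ (f ∘ Fin.suc) ys (eq ∘ Fin.suc)

rest : ∀ k → Totals n (k + n)
rest k = record
  { fun    = λ _ → dropᵛ k
  ; codes  = Vec.tabulate (proj ∘ (k ↑ʳ_))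
  ; codes⇓ = λ g xs → projs⇓ (k ↑ʳ_) (dropᵛ k xs) (lookup-dropᵛ k xs) }

infixl 8 _⟨_⟩ _↑_

_⟨_⟩ : Total m → Totals m n → Total n
t ⟨ ts ⟩ = record
  { fun   = λ g xs → fun t g (Totals.fun ts g xs)
  ; code  = comp (code t) (codes ts)
  ; code⇓ = λ g xs → comp⇓ (codes⇓ ts g xs) (code⇓ t g _) }

_↑_ : Total n → ∀ k → Total (k + n)
t ↑ k = t ⟨ rest k ⟩

var : Fin n → Total n
var i = record { fun = λ _ xs → Vec.lookup xs i ; code = proj i ; code⇓ = λ _ _ → proj⇓ }

sucᵗ : Total n → Total n
sucᵗ t = record
  { fun   = λ g xs → suc (fun t g xs)
  ; code  = comp sucᶜ (code t ∷ [])
  ; code⇓ = λ g xs → comp⇓ (code⇓ t g xs ∷ []) suc⇓ }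

oracleᵗ : Total n → Total n
oracleᵗ t = record
  { fun   = λ g xs → g (fun t g xs)
  ; code  = comp (oracle 0F) (code t ∷ [])
  ; code⇓ = λ g xs → comp⇓ (code⇓ t g xs ∷ []) oracle⇓ }

numeral : ℕ → Code k n
numeral zero    = zeroᶜ
numeral (suc x) = comp sucᶜ (numeral x ∷ [])

numeral⇓ : ∀ {gs : Vec Baire k} {xs : Vec ℕ n} x → gs ⊢ numeral x · xs ⇓ x
numeral⇓ zero    = zero⇓
numeral⇓ (suc x) = comp⇓ (numeral⇓ x ∷ []) suc⇓

constᵗ : ℕ → Total n
constᵗ x = record { fun = λ _ _ → x ; code = numeral x ; code⇓ = λ _ _ → numeral⇓ x }

recᵗ : Total n → Total (2 + n) → Total n → Total n
recᵗ z s t = record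
  { fun   = λ g xs → natrec (fun z g xs) (λ i x → fun s g (i ∷ x ∷ xs)) (fun t g xs)
  ; code  = comp (primrec (code z) (code s)) (code t ∷ codes (rest 0))
  ; code⇓ = λ g xs → comp⇓ (code⇓ t g xs ∷ codes⇓ (rest 0) g xs) (primrec⇓ g xs (fun t g xs)) }
  where
  primrec⇓ : ∀ g xs k → g ∷ [] ⊢ primrec (code z) (code s) · k ∷ xs ⇓
             natrec (fun z g xs) (λ i x → fun s g (i ∷ x ∷ xs)) k
  primrec⇓ g xs zero    = base⇓ (code⇓ z g xs)
  primrec⇓ g xs (suc k) = step⇓ (primrec⇓ g xs k) (code⇓ s g _)

if0 : ℕ → A → A → A
if0 zero    x y = x
if0 (suc _) x y = y

if0ᵗ : Total n → Total n → Total n → Total n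
if0ᵗ c t u = reshape (recᵗ t (u ↑ 2) c) (λ g xs → if0 (fun c g xs) (fun t g xs) (fun u g xs)) eq
  where
  eq : ∀ g xs → fun (recᵗ t (u ↑ 2) c) g xs ≡ if0 (fun c g xs) (fun t g xs) (fun u g xs)
  eq g xs with fun c g xs
  ... | zero  = refl
  ... | suc _ = refl

predᵗ : Total n → Total n
predᵗ t = reshape (recᵗ (constᵗ 0) (var 0F) t) (λ g xs → pred (fun t g xs)) eq
  where
  eq : ∀ g xs → fun (recᵗ (constᵗ 0) (var 0F) t) g xs ≡ pred (fun t g xs)
  eq g xs with fun t g xs
  ... | zero  = refl
  ... | suc _ = refl

infixl 6 _+ᵗ_ _∸ᵗ_

_+ᵗ_ : Total n → Total n → Total n
t +ᵗ u = reshape (recᵗ u (sucᵗ (var 1F)) t) (λ g xs → fun t g xs + fun u g xs)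
           (λ g xs → eq (fun t g xs) (fun u g xs))
  where
  eq : ∀ x y → natrec y (λ _ → suc) x ≡ x + y
  eq zero    y = refl
  eq (suc x) y = cong suc (eq x y)

_∸ᵗ_ : Total n → Total n → Total n
t ∸ᵗ u = reshape (recᵗ t (predᵗ (var 1F)) u) (λ g xs → fun t g xs ∸ fun u g xs)
           (λ g xs → eq (fun t g xs) (fun u g xs))
  where
  eq : ∀ x y → natrec x (λ _ → pred) y ≡ x ∸ y
  eq x zero    = refl
  eq x (suc y) = trans (cong pred (eq x y)) (pred[m∸n]≡m∸[1+n] x y)

2*ᵗ_ : Total n → Total n
2*ᵗ t = t +ᵗ (t +ᵗ (constᵗ 0))

applyUpTo-cong : ∀ {f h : ℕ → A} → f ≗ h → applyUpTo f ≗ applyUpTo h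
applyUpTo-cong eq zero    = refl
applyUpTo-cong eq (suc k) = cong₂ _∷_ (eq 0) (applyUpTo-cong (eq ∘ suc) k)

module _ {B : Set} where

  foldr-applyUpTo : ∀ (φ : A → B → B) b (f : ℕ → A) (h : ℕ → ℕ) k →
                    foldr (φ ∘ f) b (applyUpTo h k) ≡ foldr φ b (applyUpTo (f ∘ h) k)
  foldr-applyUpTo φ b f h zero    = refl
  foldr-applyUpTo φ b f h (suc k) = cong (φ (f (h 0))) (foldr-applyUpTo φ b f (h ∘ suc) k)

  -- Primitive recursion has to build a right fold from its innermost element: after j steps the
  -- last j of the indices below k have been treated.
  natrec-foldr : ∀ (φ : ℕ → B → B) b {k} j → j ≤ k →
                 natrec b (λ i → φ (k ∸ suc i)) j ≡ foldr φ b (applyUpTo ((k ∸ j) +_) j)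
  natrec-foldr φ b zero    j≤k = refl
  natrec-foldr φ b {k} (suc j) j<k = cong₂ φ (sym (+-identityʳ _))
    (trans (natrec-foldr φ b j (<⇒≤ j<k)) (cong (foldr φ b) (applyUpTo-cong shift j)))
    where
    shift : ∀ i → k ∸ j + i ≡ k ∸ suc j + suc i
    shift i = trans (cong (_+ i) (+-∸-assoc 1 j<k)) (sym (+-suc (k ∸ suc j) i))

foldrᵗ : Total (2 + n) → Total n → Total n → Total n
foldrᵗ φ z t = reshape (recᵗ z (φ ⟨ (t ↑ 2 ∸ᵗ sucᵗ (var 0F)) ∷ᵗ var 1F ∷ᵗ rest 2 ⟩) t)
  (λ g xs → foldr (λ i x → fun φ g (i ∷ x ∷ xs)) (fun z g xs) (upTo (fun t g xs)))
  λ g xs → let k = fun t g xs in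
    trans (natrec-foldr _ _ k ≤-refl)
          (cong (foldr _ _) (applyUpTo-cong (λ i → cong (_+ i) (n∸n≡0 k)) k))

-- Digit sequences

par half : ℕ → ℕ
par  = natrec 0 (λ _ → 1 ∸_)
half = natrec 0 (λ i → _+ par i)

parᵗ halfᵗ : Total n → Total n
parᵗ  t = recᵗ (constᵗ 0) (constᵗ 1 ∸ᵗ var 1F) t
halfᵗ t = recᵗ (constᵗ 0) (var 1F +ᵗ parᵗ (var 0F)) t

par-0⊎1 : ∀ n → par n ≡ 0 ⊎ par n ≡ 1
par-0⊎1 zero = inj₁ refl
par-0⊎1 (suc n) with par-0⊎1 n
... | inj₁ eq = inj₂ (cong (1 ∸_) eq)
... | inj₂ eq = inj₁ (cong (1 ∸_) eq)

par-2+ : ∀ n → par (2 + n) ≡ par n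
par-2+ n with par n | par-0⊎1 n
... | _ | inj₁ refl = refl
... | _ | inj₂ refl = refl

half-2+ : ∀ n → half (2 + n) ≡ suc (half n)
half-2+ n with par n | par-0⊎1 n
... | _ | inj₁ refl = trans (cong (_+ 1) (+-identityʳ _)) (+-comm _ 1)
... | _ | inj₂ refl = trans (+-identityʳ _) (+-comm _ 1)

par-2* : ∀ n → par (2 * n) ≡ 0
par-2* zero    = refl
par-2* (suc n) = trans (cong par (*-suc 2 n)) (trans (par-2+ (2 * n)) (par-2* n))

half-2* : ∀ n → half (2 * n) ≡ n
half-2* zero    = refl
half-2* (suc n) = trans (cong half (*-suc 2 n)) (trans (half-2+ (2 * n)) (cong suc (half-2* n)))

par-bit : ∀ v n → par (par v + 2 * n) ≡ par v
par-bit v n with par v | par-0⊎1 v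
... | _ | inj₁ refl = par-2* n
... | _ | inj₂ refl = cong (1 ∸_) (par-2* n)

half-bit : ∀ v n → half (par v + 2 * n) ≡ n
half-bit v n with par v | par-0⊎1 v
... | _ | inj₁ refl = half-2* n
... | _ | inj₂ refl = trans (cong₂ _+_ (half-2* n) (par-2* n)) (+-identityʳ n)

half≤ : ∀ n → half n ≤ n
half≤ zero    = z≤n
half≤ (suc n) with par n | par-0⊎1 n
... | _ | inj₁ refl = ≤-trans (≤-reflexive (+-identityʳ _)) (m≤n⇒m≤1+n (half≤ n))
... | _ | inj₂ refl = ≤-trans (≤-reflexive (+-comm _ 1)) (s≤s (half≤ n))

⊕-par : ∀ f g n → (f ⊕ g) n ≡ if0 (par n) (f (half n)) (g (half n))
⊕-par f g zero    = refl
⊕-par f g (suc n) = trans (⊕-par g (f ∘ suc) n) (swap (par-0⊎1 n))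
  where
  swap : par n ≡ 0 ⊎ par n ≡ 1 →
         if0 (par n) (g (half n)) (f (suc (half n))) ≡
         if0 (par (suc n)) (f (half (suc n))) (g (half (suc n)))
  swap p with par n
  swap (inj₁ refl) | _ = cong g (sym (+-identityʳ _))
  swap (inj₂ refl) | _ = cong f (+-comm 1 _)

-- A number stands for its sequence of base 4 digits, extended by zeros. As a
-- partial function it is undefined where the digit is 0, and has the value
-- d ∸ 1 where the digit is d.

lo hi : ℕ → ℕ
lo t = par t + 2 * par (half t)
hi   = half ∘ half

loᵗ hiᵗ : Total n → Total n
loᵗ t = parᵗ t +ᵗ 2*ᵗ parᵗ (halfᵗ t)
hiᵗ t = halfᵗ (halfᵗ t)

opaque

  -- This is (d mod 4) + 4t. Any number may be given as a digit, and only `lo d`, its residue,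
  -- survives; hence the `lo` in the laws below.
  cons : ℕ → ℕ → ℕ
  cons d t = par d + 2 * (par (half d) + 2 * t)

  dig : ℕ → ℕ → ℕ
  dig t i = lo (natrec t (λ _ → hi) i)

  lo-cons : ∀ d t → lo (cons d t) ≡ lo d
  lo-cons d t
    rewrite par-bit d (par (half d) + 2 * t) | half-bit d (par (half d) + 2 * t)
          | par-bit (half d) t = refl

  hi-cons : ∀ d t → hi (cons d t) ≡ t
  hi-cons d t
    rewrite half-bit d (par (half d) + 2 * t) | half-bit (half d) t = refl

  dig-suc : ∀ t i → dig t (suc i) ≡ dig (hi t) i
  dig-suc t i = cong lo (hi-natrec i)
    where
    hi-natrec : ∀ i → hi (natrec t (λ _ → hi) i) ≡ natrec (hi t) (λ _ → hi) i
    hi-natrec zero    = refl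
    hi-natrec (suc i) = cong hi (hi-natrec i)

  dig-cons-zero : ∀ d t → dig (cons d t) 0 ≡ lo d
  dig-cons-zero = lo-cons

  dig-cons-suc : ∀ d t i → dig (cons d t) (suc i) ≡ dig t i
  dig-cons-suc d t i = trans (dig-suc (cons d t) i) (cong (λ x → dig x i) (hi-cons d t))

  dig-zero : ∀ i → dig 0 i ≡ 0
  dig-zero zero    = refl
  dig-zero (suc i) = trans (dig-suc 0 i) (dig-zero i)

  lo-lo : ∀ t → lo (lo t) ≡ lo t
  lo-lo t = trans (cong (λ x → lo (par t + 2 * x)) (sym (+-identityʳ (par (half t))))) (lo-cons t 0)

  lo-dig : ∀ t i → lo (dig t i) ≡ dig t i
  lo-dig t i = lo-lo (natrec t (λ _ → hi) i)

  m≤cons : ∀ d t → t ≤ cons d t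
  m≤cons d t = begin
    t                                     ≤⟨ m≤m+n t _ ⟩
    2 * t                                 ≤⟨ m≤n+m (2 * t) (par (half d)) ⟩
    par (half d) + 2 * t                  ≤⟨ m≤m+n _ _ ⟩
    2 * (par (half d) + 2 * t)            ≤⟨ m≤n+m _ (par d) ⟩
    cons d t                              ∎
    where open ≤-Reasoning

  cons≤suc⇒≤ : ∀ d t {k} → cons d t ≤ suc k → t ≤ k
  cons≤suc⇒≤ d zero    le = z≤n
  cons≤suc⇒≤ d (suc t) le = s≤s⁻¹ (≤-trans (begin
    suc (suc t)                           ≤⟨ s≤s (m≤n+m (suc t) t) ⟩
    suc t + suc t                         ≤⟨ +-monoʳ-≤ (suc t) (m≤m+n (suc t) 0) ⟩
    2 * suc t                             ≤⟨ m≤n+m _ (par (half d)) ⟩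
    par (half d) + 2 * suc t              ≤⟨ m≤m+n _ _ ⟩
    2 * (par (half d) + 2 * suc t)        ≤⟨ m≤n+m _ (par d) ⟩
    cons d (suc t)                        ∎) le)
    where open ≤-Reasoning

  m<cons-3 : ∀ t → t < cons 3 t
  m<cons-3 t = s≤s (≤-trans (m≤m+n t _) (≤-trans (m≤n+m _ 1) (m≤m+n _ _)))

  cons-total : (d t : Total n) →
               Σ[ r ∈ Total n ] ∀ g xs → fun r g xs ≡ cons (fun d g xs) (fun t g xs)
  cons-total d t = parᵗ d +ᵗ 2*ᵗ (parᵗ (halfᵗ d) +ᵗ 2*ᵗ t) , λ _ _ → refl

  dig-total : (t i : Total n) →
              Σ[ r ∈ Total n ] ∀ g xs → fun r g xs ≡ dig (fun t g xs) (fun i g xs)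
  dig-total t i = loᵗ (recᵗ t (hiᵗ (var 1F)) i) , λ _ _ → refl

consᵗ digᵗ : Total n → Total n → Total n
consᵗ d t = let r , r≡ = cons-total d t in reshape r (λ g xs → cons (fun d g xs) (fun t g xs)) r≡
digᵗ t i  = let r , r≡ = dig-total t i in reshape r (λ g xs → dig (fun t g xs) (fun i g xs)) r≡

-- A number has at most as many significant base 4 digits as its own value, so the bound t costs
-- nothing but extra zeros, and no length has to be stored.
digits : ℕ → List ℕ
digits t = applyUpTo (dig t) t

fromDigits : List ℕ → ℕ
fromDigits = foldr cons 0

digitFoldᵗ : Total (2 + n) → Total n → Total n → Total n
digitFoldᵗ φ z t = reshape (foldrᵗ (φ ⟨ digᵗ (t ↑ 2) (var 0F) ∷ᵗ var 1F ∷ᵗ rest 2 ⟩) z t)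
  (λ g xs → foldr (λ d x → fun φ g (d ∷ x ∷ xs)) (fun z g xs) (digits (fun t g xs)))
  (λ g xs → foldr-applyUpTo _ _ _ id (fun t g xs))

-- The list of digits read off may end early or carry extra zeros; a fold
-- which skips zeros does not see the difference.

module _ {A : Set} (φ : ℕ → A → A) (skip : ∀ x → φ 0 x ≡ x) (x : A) where

  foldr-digits-0 : ∀ k → foldr φ x (applyUpTo (dig 0) k) ≡ x
  foldr-digits-0 k = trans (cong (foldr φ x) (applyUpTo-cong dig-zero k)) (zeros k)
    where
    zeros : ∀ k → foldr φ x (applyUpTo (λ _ → 0) k) ≡ x
    zeros zero    = refl
    zeros (suc k) = trans (skip _) (zeros k)

  foldr-digits-≤ : ∀ ds k → fromDigits ds ≤ k →
                   foldr φ x (applyUpTo (dig (fromDigits ds)) k) ≡ foldr (φ ∘ lo) x ds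
  foldr-digits-≤ []       k       le = foldr-digits-0 k
  -- The code is 0 here, so d and all later digits are 0 modulo 4 and are skipped.
  foldr-digits-≤ (d ∷ ds) zero    le = sym (begin
    φ (lo d) (foldr (φ ∘ lo) x ds) ≡⟨ cong (λ y → φ y (foldr (φ ∘ lo) x ds)) lo≡0 ⟩
    φ 0 (foldr (φ ∘ lo) x ds)      ≡⟨ skip _ ⟩
    foldr (φ ∘ lo) x ds            ≡⟨ foldr-digits-≤ ds 0 (≤-trans (m≤cons d (fromDigits ds)) le) ⟨
    x                              ∎)
    where
    open ≡-Reasoning
    lo≡0 : lo d ≡ 0
    lo≡0 = trans (sym (lo-cons d (fromDigits ds))) (cong lo (n≤0⇒n≡0 le))
  foldr-digits-≤ (d ∷ ds) (suc k) le = cong₂ φ (dig-cons-zero d (fromDigits ds)) (trans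
    (cong (foldr φ x) (applyUpTo-cong (dig-cons-suc d (fromDigits ds)) k))
    (foldr-digits-≤ ds k (cons≤suc⇒≤ d (fromDigits ds) le)))

  foldr-digits-fromDigits : ∀ ds → foldr φ x (digits (fromDigits ds)) ≡ foldr (φ ∘ lo) x ds
  foldr-digits-fromDigits ds = foldr-digits-≤ ds _ ≤-refl

foldr-lo-digits : ∀ (φ : ℕ → A → A) x t → foldr (φ ∘ lo) x (digits t) ≡ foldr φ x (digits t)
foldr-lo-digits {A = A} φ x t = go (dig t) (lo-dig t) t
  where
  go : ∀ f → (∀ i → lo (f i) ≡ f i) → ∀ k →
       foldr (φ ∘ lo) x (applyUpTo f k) ≡ foldr φ x (applyUpTo f k)
  go f eq zero    = refl
  go f eq (suc k) = cong₂ φ (eq 0) (go (f ∘ suc) (eq ∘ suc) k)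

build : (ℕ → ℕ) → List ℕ → ℕ
build v = foldr (cons ∘ v) 0

module _ (v : ℕ → ℕ) where

  dig-build-< : ∀ {i} k (f : ℕ → ℕ) → i < k → dig (build v (applyUpTo f k)) i ≡ lo (v (f i))
  dig-build-< {zero}  (suc k) f lt = dig-cons-zero (v (f 0)) (build v (applyUpTo (f ∘ suc) k))
  dig-build-< {suc i} (suc k) f lt =
    trans (dig-cons-suc (v (f 0)) (build v (applyUpTo (f ∘ suc) k)) i)
          (dig-build-< k (f ∘ suc) (s<s⁻¹ lt))

  dig-build-≥ : ∀ {i} k (f : ℕ → ℕ) → k ≤ i → dig (build v (applyUpTo f k)) i ≡ 0
  dig-build-≥ {i}     zero    f le = dig-zero i
  dig-build-≥ {suc i} (suc k) f le =
    trans (dig-cons-suc (v (f 0)) (build v (applyUpTo (f ∘ suc) k)) i)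
          (dig-build-≥ k (f ∘ suc) (s≤s⁻¹ le))

-- Bounded evaluation

-- Evaluation results are shifted by one. Thus v = 1 is the zero that `μ` looks for, v ≥ 2 lets the
-- search go on, and v = 0, an undefined value, must make the whole search fail, since `μ` requires
-- all earlier values to be defined.
pick : ℕ → ℕ → ℕ → ℕ
pick v w x = if0 v 0 (if0 (pred v) (suc w) x)

search : (ℕ → ℕ) → List ℕ → ℕ
search v = foldr (λ w → pick (v w) w) 0

module _ (v : ℕ → ℕ) where

  search-sound : ∀ k (f : ℕ → ℕ) {x} → search v (applyUpTo f k) ≡ suc x →
                 ∃[ j ] x ≡ f j × v (f j) ≡ 1 × (∀ {i} → i < j → ∃[ u ] v (f i) ≡ suc (suc u))
  search-sound (suc k) f eq with v (f 0) in v≡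
  search-sound (suc k) f refl | suc zero = 0 , refl , v≡ , λ ()
  ... | suc (suc u) with search-sound k (f ∘ suc) eq
  ...   | j , x≡ , v≡1 , below = suc j , x≡ , v≡1 , below′
    where
    below′ : ∀ {i} → i < suc j → ∃[ u ] v (f i) ≡ suc (suc u)
    below′ {zero}  _  = u , v≡
    below′ {suc i} lt = below (s<s⁻¹ lt)

  search-complete : ∀ {k} (f : ℕ → ℕ) {j} → j < k → v (f j) ≡ 1 →
                    (∀ {i} → i < j → ∃[ u ] v (f i) ≡ suc (suc u)) →
                    search v (applyUpTo f k) ≡ suc (f j)
  search-complete {suc k} f {zero}  j<k v≡1 below rewrite v≡1 = refl
  search-complete {suc k} f {suc j} j<k v≡1 below
    rewrite proj₂ (below {0} z<s) = search-complete (f ∘ suc) (s<s⁻¹ j<k) v≡1 (below ∘ s<s)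

defined : Vec ℕ n → ℕ
defined []       = 1
defined (v ∷ vs) = if0 v 0 (defined vs)

-- Evaluation relative to a partial oracle and with the bound s on all
-- searches; the value 0 means that no value has been found.

eval  : Code 1 n → (ℕ → ℕ) → ℕ → Vec ℕ n → ℕ
evals : Vec (Code 1 n) m → (ℕ → ℕ) → ℕ → Vec ℕ n → Vec ℕ m

eval zeroᶜ         o s xs       = 1
eval sucᶜ          o s (x ∷ []) = suc (suc x)
eval (proj i)      o s xs       = suc (Vec.lookup xs i)
eval (oracle 0F)   o s (x ∷ []) = o x
eval (comp c ds)   o s xs       =
  if0 (defined (evals ds o s xs)) 0 (eval c o s (Vec.map pred (evals ds o s xs)))
eval (primrec c d) o s (x ∷ xs) =
  natrec (eval c o s xs) (λ i v → if0 v 0 (eval d o s (i ∷ pred v ∷ xs))) x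
eval (μ c)         o s xs       = search (λ w → eval c o s (w ∷ xs)) (upTo s)

evals []       o s xs = []
evals (d ∷ ds) o s xs = eval d o s xs ∷ evals ds o s xs

infix 4 _⊑_

-- The partial function o, with values shifted by one, is contained in G; this is what soundness of
-- evaluation asks for. Completeness asks for `Agree`: o is defined and correct below N, and
-- arbitrary from N on.
_⊑_ : (ℕ → ℕ) → Baire → Set
o ⊑ G = ∀ x {y} → o x ≡ suc y → G x ≡ y

Agree : ℕ → (ℕ → ℕ) → Baire → Set
Agree N o G = ∀ {x} → x < N → o x ≡ suc (G x)

module _ {o : ℕ → ℕ} {G : Baire} (o⊑G : o ⊑ G) {s : ℕ} where

  eval-sound  : ∀ (c : Code 1 n) xs {y} → eval c o s xs ≡ suc y → G ∷ [] ⊢ c · xs ⇓ y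
  evals-sound : ∀ (ds : Vec (Code 1 n) m) xs {z} → defined (evals ds o s xs) ≡ suc z →
                Pointwise (λ d y → G ∷ [] ⊢ d · xs ⇓ y) ds (Vec.map pred (evals ds o s xs))

  eval-sound zeroᶜ         xs           refl = zero⇓
  eval-sound sucᶜ          (x ∷ [])     refl = suc⇓
  eval-sound (proj i)      xs           refl = proj⇓
  eval-sound (oracle 0F)   (x ∷ [])     eq   =
    subst (G ∷ [] ⊢ oracle 0F · x ∷ [] ⇓_) (o⊑G x eq) oracle⇓
  eval-sound (comp c ds)   xs           eq with defined (evals ds o s xs) in eqs
  ... | suc _ = comp⇓ (evals-sound ds xs eqs) (eval-sound c _ eq)
  eval-sound (primrec c d) (x ∷ xs)     eq = primrec-sound x eq
    where
    primrec-sound : ∀ x {y} → eval (primrec c d) o s (x ∷ xs) ≡ suc y →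
                    G ∷ [] ⊢ primrec c d · x ∷ xs ⇓ y
    primrec-sound zero    eq = base⇓ (eval-sound c xs eq)
    primrec-sound (suc x) eq with eval (primrec c d) o s (x ∷ xs) in eqx
    ... | suc v = step⇓ (primrec-sound x eqx) (eval-sound d _ eq)
  eval-sound (μ c)         xs           eq
    with search-sound (λ w → eval c o s (w ∷ xs)) s id eq
  ... | j , refl , v≡1 , below =
    μ⇓ (eval-sound c _ v≡1) (λ w<j → proj₁ (below w<j) , eval-sound c _ (proj₂ (below w<j)))

  evals-sound []       xs eq = []
  evals-sound (d ∷ ds) xs eq with eval d o s xs in eqd
  ... | suc v = eval-sound d xs eqd ∷ evals-sound ds xs eq

-- One N bounds both the search and the part of the oracle consulted. As all larger s are included,
-- the bounds of subderivations combine by maximum.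
Eventually : Baire → (ℕ → (ℕ → ℕ) → Set) → Set
Eventually G A = ∃[ N ] ∀ {s o} → N ≤ s → Agree N o G → A s o

Agree-≤ : ∀ {M N o G} → M ≤ N → Agree N o G → Agree M o G
Agree-≤ M≤N agree x<M = agree (<-≤-trans x<M M≤N)

module _ {G : Baire} where

  always : ∀ {A} → (∀ {s o} → A s o) → Eventually G A
  always p = 0 , λ _ _ → p

  eventually-map₂ : ∀ {A B C} → (∀ {s o} → A s o → B s o → C s o) →
                    Eventually G A → Eventually G B → Eventually G C
  eventually-map₂ f (M , p) (N , q) = M ⊔ N , λ le agree →
    f (p (m⊔n≤o⇒m≤o M N le) (Agree-≤ (m≤m⊔n M N) agree))
      (q (m⊔n≤o⇒n≤o M N le) (Agree-≤ (m≤n⊔m M N) agree))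

  eventually-map : ∀ {A B} → (∀ {s o} → A s o → B s o) → Eventually G A → Eventually G B
  eventually-map f (M , p) = M , λ le agree → f (p le agree)

  eventually-∀< : ∀ {A : ℕ → ℕ → (ℕ → ℕ) → Set} x → (∀ {w} → w < x → Eventually G (A w)) →
                  Eventually G (λ s o → ∀ {w} → w < x → A w s o)
  eventually-∀< zero    p = always λ ()
  eventually-∀< {A} (suc x) p = eventually-map₂ both (p ≤-refl) (eventually-∀< x (p ∘ m<n⇒m<1+n))
    where
    both : ∀ {s o} → A x s o → (∀ {w} → w < x → A w s o) → ∀ {w} → w < suc x → A w s o
    both q qs w<1+x with m<1+n⇒m<n∨m≡n w<1+x
    ... | inj₁ w<x  = qs w<x
    ... | inj₂ refl = q

  eventually-< : ∀ x → Eventually G (λ s _ → x < s)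
  eventually-< x = suc x , λ x<s _ → x<s

  defined-map-suc : ∀ (ys : Vec ℕ n) → defined (Vec.map suc ys) ≡ 1
  defined-map-suc []       = refl
  defined-map-suc (y ∷ ys) = defined-map-suc ys

  map-pred-suc : ∀ (ys : Vec ℕ n) → Vec.map pred (Vec.map suc ys) ≡ ys
  map-pred-suc []       = refl
  map-pred-suc (y ∷ ys) = cong (y ∷_) (map-pred-suc ys)

  eval-complete  : ∀ {c : Code 1 n} {xs y} → G ∷ [] ⊢ c · xs ⇓ y →
                   Eventually G (λ s o → eval c o s xs ≡ suc y)
  evals-complete : ∀ {ds : Vec (Code 1 n) m} {xs ys} →
                   Pointwise (λ d y → G ∷ [] ⊢ d · xs ⇓ y) ds ys →
                   Eventually G (λ s o → evals ds o s xs ≡ Vec.map suc ys)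

  eval-complete zero⇓             = always refl
  eval-complete suc⇓              = always refl
  eval-complete proj⇓             = always refl
  eval-complete (oracle⇓ {0F} {x}) = suc x , λ _ agree → agree ≤-refl
  eval-complete (comp⇓ {c = c} {ds} {xs} {ys} ps p) =
    eventually-map₂ both (evals-complete ps) (eval-complete p)
    where
    both : ∀ {s o z} → evals ds o s xs ≡ Vec.map suc ys → eval c o s ys ≡ z →
           eval (comp c ds) o s xs ≡ z
    both eqs eq rewrite eqs | defined-map-suc ys | map-pred-suc ys = eq
  eval-complete (base⇓ p)         = eval-complete p
  eval-complete (step⇓ {c = c} {d} {xs} {x} {y} p q) =
    eventually-map₂ both (eval-complete p) (eval-complete q)
    where
    both : ∀ {s o z} → eval (primrec c d) o s (x ∷ xs) ≡ suc y → eval d o s (x ∷ y ∷ xs) ≡ z →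
           eval (primrec c d) o s (suc x ∷ xs) ≡ z
    both eq eq′ rewrite eq = eq′
  eval-complete (μ⇓ {c = c} {xs} {x} p ps) =
    eventually-map₂ {B = λ s o → ∀ {w} → w < x → Below w s o} found
      (eventually-map₂ _,_ (eventually-< x) (eval-complete p))
      (eventually-∀< x (λ w<x → eventually-map (_ ,_) (eval-complete (proj₂ (ps w<x)))))
    where
    Below : ℕ → ℕ → (ℕ → ℕ) → Set
    Below w s o = ∃[ u ] eval c o s (w ∷ xs) ≡ suc (suc u)
    found : ∀ {s o} → x < s × eval c o s (x ∷ xs) ≡ 1 → (∀ {w} → w < x → Below w s o) →
            eval (μ c) o s xs ≡ suc x
    found (x<s , eq) below = search-complete _ id x<s eq below

  evals-complete []       = always refl
  evals-complete (p ∷ ps) =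
    eventually-map₂ (cong₂ _∷_) (eval-complete p) (evals-complete ps)

-- By completeness at G the evaluator finds y with bound N from any oracle that agrees with G below
-- N, such as `suc ∘ H`; soundness at H turns this back into a derivation.
use-principle : ∀ {G : Baire} {c : Code 1 n} {xs y} → G ∷ [] ⊢ c · xs ⇓ y →
                ∃[ N ] ∀ {H} → (∀ {i} → i < N → G i ≡ H i) → H ∷ [] ⊢ c · xs ⇓ y
use-principle {c = c} {xs} p =
  let N , q = eval-complete p in
  N , λ {H} eq → eval-sound {o = suc ∘ H} (λ _ → cong pred) c xs (q ≤-refl λ i<N → cong suc (sym (eq i<N)))

-- The evaluator is a function, and at a common large bound it returns both values.
⇓-functional : ∀ {G : Baire} {c : Code 1 n} {xs y z} →
               G ∷ [] ⊢ c · xs ⇓ y → G ∷ [] ⊢ c · xs ⇓ z → y ≡ z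
⇓-functional {G = G} p q =
  let M , eq = eval-complete p ; N , eq′ = eval-complete q in
  cong pred (trans (sym (eq {o = suc ∘ G} (m≤m⊔n M N) λ _ → refl)) (eq′ (m≤n⊔m M N) λ _ → refl))

-- If e halted on X, it would halt with finite use, hence also on an element Y of P that agrees with
-- X up to that use.
Π⁰₁-closed : ∀ {P} → IsΠ⁰₁ P → ∀ {X} → (∀ N → ∃[ Y ] Y ∈ P × (∀ {i} → i < N → X i ≡ Y i)) → X ∈ P
Π⁰₁-closed (e , P⊆ , ⊆P) approx = ⊆P λ (y , X⇓) →
  let N , Y⇓ = use-principle X⇓
      Y , Y∈P , X≡Y = approx N
  in P⊆ Y∈P (y , Y⇓ λ i<N → cong toℕ (X≡Y i<N))

-- The partial oracle X ⊕ g, for X the partial function given by τ.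

_⊕ₚ_ : ℕ → Baire → ℕ → ℕ
(τ ⊕ₚ g) x = if0 (par x) (dig τ (half x)) (suc (g (half x)))

⊕ₚ-⊑ : ∀ {τ X g} → dig τ ⊑ X → τ ⊕ₚ g ⊑ X ⊕ g
⊕ₚ-⊑ {τ} {X} {g} τ⊑X x eq rewrite ⊕-par X g x with par x
... | zero  = τ⊑X (half x) eq
... | suc _ = cong pred eq

⊕ₚ-Agree : ∀ {N τ X g} → Agree N (dig τ) X → Agree N (τ ⊕ₚ g) (X ⊕ g)
⊕ₚ-Agree {N} {τ} {X} {g} agree {x} x<N rewrite ⊕-par X g x with par x
... | zero  = agree (≤-<-trans (half≤ x) x<N)
... | suc _ = refl

evalF : Code 1 n → Baire → Vec ℕ (2 + n) → ℕ
evalF c g (s ∷ τ ∷ xs) = eval c (τ ⊕ₚ g) s xs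

definedF : Vec (Code 1 n) m → Baire → Vec ℕ (2 + n) → ℕ
definedF ds g (s ∷ τ ∷ xs) = defined (evals ds (τ ⊕ₚ g) s xs)

predF : Vec (Code 1 n) m → Baire → Vec ℕ (2 + n) → Vec ℕ m
predF ds g (s ∷ τ ∷ xs) = Vec.map pred (evals ds (τ ⊕ₚ g) s xs)

-- By recursion on the code rather than on its Gödel number, so that no
-- universal functional is needed.

module Evaluator where

  code-eval    : Code 1 n → Total (2 + n)
  code-defined : Vec (Code 1 n) m → Total (2 + n)
  code-pred    : Vec (Code 1 n) m → Totals m (2 + n)

  code-eval≡    : ∀ (c : Code 1 n) g xs → fun (code-eval c) g xs ≡ evalF c g xs
  code-defined≡ : ∀ (ds : Vec (Code 1 n) m) g xs → fun (code-defined ds) g xs ≡ definedF ds g xs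
  code-pred≡    : ∀ (ds : Vec (Code 1 n) m) g xs → Totals.fun (code-pred ds) g xs ≡ predF ds g xs

  -- Recursive calls go through this reshaped version, so the equations below need only one
  -- unfolding and hold by `refl`.
  evalᵗ : Code 1 n → Total (2 + n)
  evalᵗ c = reshape (code-eval c) (evalF c) (code-eval≡ c)

  definedᵗ : Vec (Code 1 n) m → Total (2 + n)
  definedᵗ ds = reshape (code-defined ds) (definedF ds) (code-defined≡ ds)

  predsᵗ : Vec (Code 1 n) m → Totals m (2 + n)
  predsᵗ ds = reshapes (code-pred ds) (predF ds) (code-pred≡ ds)

  code-eval zeroᶜ         = constᵗ 1
  code-eval sucᶜ          = sucᵗ (sucᵗ (var 2F))
  code-eval (proj i)      = sucᵗ (var (2 ↑ʳ i))
  code-eval (oracle 0F)   = if0ᵗ (parᵗ (var 2F)) (digᵗ (var 1F) (halfᵗ (var 2F)))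
                                 (sucᵗ (oracleᵗ (halfᵗ (var 2F))))
  code-eval (comp c ds)   = if0ᵗ (definedᵗ ds) (constᵗ 0)
                                 (evalᵗ c ⟨ var 0F ∷ᵗ var 1F ∷ᵗ predsᵗ ds ⟩)
  code-eval (primrec c d) = recᵗ (evalᵗ c ⟨ var 0F ∷ᵗ var 1F ∷ᵗ rest 3 ⟩)
    (if0ᵗ (var 1F) (constᵗ 0)
          (evalᵗ d ⟨ var 2F ∷ᵗ var 3F ∷ᵗ var 0F ∷ᵗ predᵗ (var 1F) ∷ᵗ rest 5 ⟩))
    (var 2F)
  code-eval (μ c)         = foldrᵗ
    (let v = evalᵗ c ⟨ var 2F ∷ᵗ var 3F ∷ᵗ var 0F ∷ᵗ rest 4 ⟩ in
     if0ᵗ v (constᵗ 0) (if0ᵗ (predᵗ v) (sucᵗ (var 0F)) (var 1F)))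
    (constᵗ 0) (var 0F)

  code-defined []       = constᵗ 1
  code-defined (d ∷ ds) = if0ᵗ (evalᵗ d) (constᵗ 0) (definedᵗ ds)

  code-pred []       = []ᵗ
  code-pred (d ∷ ds) = predᵗ (evalᵗ d) ∷ᵗ predsᵗ ds

  code-eval≡ zeroᶜ         g (s ∷ τ ∷ xs)     = refl
  code-eval≡ sucᶜ          g (s ∷ τ ∷ x ∷ []) = refl
  code-eval≡ (proj i)      g (s ∷ τ ∷ xs)     = refl
  code-eval≡ (oracle 0F)   g (s ∷ τ ∷ x ∷ []) = refl
  code-eval≡ (comp c ds)   g (s ∷ τ ∷ xs)     = refl
  code-eval≡ (primrec c d) g (s ∷ τ ∷ x ∷ xs) = refl
  code-eval≡ (μ c)         g (s ∷ τ ∷ xs)     = refl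

  code-defined≡ []       g (s ∷ τ ∷ xs) = refl
  code-defined≡ (d ∷ ds) g (s ∷ τ ∷ xs) = refl

  code-pred≡ []       g (s ∷ τ ∷ xs) = refl
  code-pred≡ (d ∷ ds) g (s ∷ τ ∷ xs) = refl

open Evaluator using (evalᵗ)

-- Strings and words

onDigit : ℕ → A → A → A → A → A
onDigit d x₀ x₁ x₂ x₃ = if0 d x₀ (if0 (pred d) x₁ (if0 (pred (pred d)) x₂ x₃))

onDigitᵗ : Total n → Total n → Total n → Total n → Total n → Total n
onDigitᵗ d t₀ t₁ t₂ t₃ = if0ᵗ d t₀ (if0ᵗ (predᵗ d) t₁ (if0ᵗ (predᵗ (predᵗ d)) t₂ t₃))

-- In the string coded by a number, the digits 1 and 2 stand for the bits 0
-- and 1; all other digits are ignored.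

onBit : (Fin 2 → A → A) → ℕ → A → A
onBit β d x = onDigit d x (β 0F x) (β 1F x) x

bits : List ℕ → String
bits = foldr (onBit _∷_) []

string : ℕ → String
string = bits ∘ digits

bitDigits : String → List ℕ
bitDigits = List.map (suc ∘ toℕ)

prefix : String → ℕ → ℕ
prefix σ τ = foldr (λ b → cons (suc (toℕ b))) τ σ

foldr-onBit : ∀ (β : Fin 2 → A → A) x ds → foldr (onBit β) x ds ≡ foldr β x (bits ds)
foldr-onBit β x []                        = refl
foldr-onBit β x (0 ∷ ds)                  = foldr-onBit β x ds
foldr-onBit β x (1 ∷ ds)                  = cong (β 0F) (foldr-onBit β x ds)
foldr-onBit β x (2 ∷ ds)                  = cong (β 1F) (foldr-onBit β x ds)
foldr-onBit β x (suc (suc (suc _)) ∷ ds)  = foldr-onBit β x ds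

lo-bit : ∀ (b : Fin 2) → lo (suc (toℕ b)) ≡ suc (toℕ b)
lo-bit 0F = refl
lo-bit 1F = refl

string-fromDigits : ∀ ds → string (fromDigits ds) ≡ foldr (onBit _∷_ ∘ lo) [] ds
string-fromDigits ds = foldr-digits-fromDigits (onBit _∷_) (λ _ → refl) [] ds

bits-bitDigits : ∀ σ → foldr (onBit _∷_ ∘ lo) [] (bitDigits σ) ≡ σ
bits-bitDigits []       = refl
bits-bitDigits (0F ∷ σ) = cong (0F ∷_) (bits-bitDigits σ)
bits-bitDigits (1F ∷ σ) = cong (1F ∷_) (bits-bitDigits σ)

-- Ignored leading digits make the code of σ as large as needed for its use as
-- a bound on searches.

pad : ℕ → String → ℕ
pad k σ = fromDigits (replicate k 3 ++ bitDigits σ)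

string-pad : ∀ k σ → string (pad k σ) ≡ σ
string-pad k σ = trans (string-fromDigits (replicate k 3 ++ bitDigits σ)) (go k)
  where
  go : ∀ k → foldr (onBit _∷_ ∘ lo) [] (replicate k 3 ++ bitDigits σ) ≡ σ
  go zero    = bits-bitDigits σ
  go (suc k) = go k

k≤pad : ∀ k σ → k ≤ pad k σ
k≤pad zero    σ = z≤n
k≤pad (suc k) σ = ≤-<-trans (k≤pad k σ) (m<cons-3 (pad k σ))

pad-exists : ∀ k σ → ∃[ z ] k ≤ z × string z ≡ σ
pad-exists k σ = pad k σ , k≤pad k σ , string-pad k σ

prefixᵗ : Total n → Total n → Total n
prefixᵗ z t = reshape
  (digitFoldᵗ (onDigitᵗ (var 0F) (var 1F) (consᵗ (constᵗ 1) (var 1F)) (consᵗ (constᵗ 2) (var 1F)) (var 1F)) t z)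
  (λ g xs → prefix (string (fun z g xs)) (fun t g xs))
  (λ g xs → foldr-onBit (λ b → cons (suc (toℕ b))) (fun t g xs) (digits (fun z g xs)))

⌜⌝-++ : ∀ σ ρ → ⌜ σ ++ ρ ⌝ ≡ foldr (λ i x → suc (toℕ i + 2 * x)) ⌜ ρ ⌝ σ
⌜⌝-++ []      ρ = refl
⌜⌝-++ (i ∷ σ) ρ = cong (λ x → suc (toℕ i + 2 * x)) (⌜⌝-++ σ ρ)

⌜string_++_⌝ᵗ : Total n → String → Total n
⌜string t ++ ρ ⌝ᵗ = reshape
  (digitFoldᵗ (onDigitᵗ (var 0F) (var 1F) (sucᵗ (2*ᵗ var 1F)) (sucᵗ (sucᵗ (2*ᵗ var 1F))) (var 1F)) (constᵗ ⌜ ρ ⌝) t)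
  (λ g xs → ⌜ string (fun t g xs) ++ ρ ⌝)
  (λ g xs → trans (foldr-onBit (λ i x → suc (toℕ i + 2 * x)) ⌜ ρ ⌝ (digits (fun t g xs)))
                  (sym (⌜⌝-++ (string (fun t g xs)) ρ)))

module Membership {T : Pred String 0ℓ} (T-computable : Computable T) where

  χ : String → ℕ
  χ σ with proj₂ T-computable σ
  ... | inj₁ _ = 1
  ... | inj₂ _ = 0

  χ≡0⇒∉ : ∀ σ → χ σ ≡ 0 → σ ∉ T
  χ≡0⇒∉ σ eq with proj₂ T-computable σ
  χ≡0⇒∉ σ () | inj₁ _
  ... | inj₂ (σ∉T , _) = σ∉T

  χ≡suc⇒∈ : ∀ σ {x} → χ σ ≡ suc x → σ ∈ T
  χ≡suc⇒∈ σ eq with proj₂ T-computable σ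
  ... | inj₁ (σ∈T , _) = σ∈T
  χ≡suc⇒∈ σ () | inj₂ _

  ∈⇒χ≡1 : ∀ {σ} → σ ∈ T → χ σ ≡ 1
  ∈⇒χ≡1 {σ} σ∈T with proj₂ T-computable σ
  ... | inj₁ _         = refl
  ... | inj₂ (σ∉T , _) = ⊥-elim (σ∉T σ∈T)

  ∉⇒χ≡0 : ∀ {σ} → σ ∉ T → χ σ ≡ 0
  ∉⇒χ≡0 {σ} σ∉T with proj₂ T-computable σ
  ... | inj₁ (σ∈T , _) = ⊥-elim (σ∉T σ∈T)
  ... | inj₂ _         = refl

  χᵗ : Total n → String → Total n
  χᵗ t ρ = record
    { fun   = λ g xs → χ (string (fun t g xs) ++ ρ)
    ; code  = comp (sub (λ ()) (proj₁ T-computable)) (code ⌜string t ++ ρ ⌝ᵗ ∷ [])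
    ; code⇓ = λ g xs → comp⇓ (code⇓ ⌜string t ++ ρ ⌝ᵗ g xs ∷ []) (sub⇓ (λ ()) (χ⇓ (string (fun t g xs) ++ ρ))) }
    where
    χ⇓ : ∀ σ → [] ⊢ proj₁ T-computable · ⌜ σ ⌝ ∷ [] ⇓ χ σ
    χ⇓ σ with proj₂ T-computable σ
    ... | inj₁ (_ , ⇓1) = ⇓1
    ... | inj₂ (_ , ⇓0) = ⇓0

-- F acts on finite partial functions with search bound s and approximates a continuous map taking X
-- to Y. The first clause, valid for every s, says that parts of X yield only correct bits of Y; the
-- second, that enough of X and a large s yield any given number of bits.
Transforms : (ℕ → ℕ → ℕ) → Cantor → Cantor → Set
Transforms F X Y =
  (∀ {s τ} → dig τ ⊑ toℕ ∘ X → dig (F s τ) ⊑ toℕ ∘ Y) ×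
  (∀ K → ∃[ M ] ∀ {s τ} → M ≤ s → Agree M (dig τ) (toℕ ∘ X) → Agree K (dig (F s τ)) (toℕ ∘ Y))

transforms-id : ∀ {X} → Transforms (λ _ τ → τ) X X
transforms-id = id , λ K → K , λ _ → id

transforms-∘ : ∀ {F G X Y Z} → Transforms F X Y → Transforms G Y Z →
               Transforms (λ s τ → G s (F s τ)) X Z
transforms-∘ (F⊑ , F-agree) (G⊑ , G-agree) = G⊑ ∘ F⊑ , λ K →
  let M , G-agree-K = G-agree K ; N , F-agree-M = F-agree M in
  M ⊔ N , λ le agree →
    G-agree-K (m⊔n≤o⇒m≤o M N le)
              (F-agree-M (m⊔n≤o⇒n≤o M N le) (Agree-≤ (m≤n⊔m M N) agree))

transforms-cong : ∀ {F G X Y} → (∀ s τ → F s τ ≡ G s τ) → Transforms F X Y → Transforms G X Y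
transforms-cong {X = X} {Y} eq (F⊑ , F-agree) =
  (λ {s} {τ} τ⊑X → subst (λ t → dig t ⊑ toℕ ∘ Y) (eq s τ) (F⊑ τ⊑X)) ,
  (λ K → proj₁ (F-agree K) , λ {s} {τ} le agree →
    subst (λ t → Agree K (dig t) (toℕ ∘ Y)) (eq s τ) (proj₂ (F-agree K) le agree))

suc-lo-bit : ∀ {y} (b : Fin 2) → lo (suc (toℕ b)) ≡ suc y → toℕ b ≡ y
suc-lo-bit b eq = cong pred (trans (sym (lo-bit b)) eq)

transforms-prefix : ∀ σ {X} → Transforms (λ _ → prefix σ) X (σ ⌢ X)
transforms-prefix []      = transforms-id
transforms-prefix (b ∷ σ) = transforms-∘ (transforms-prefix σ) (transforms-cons b)
  where
  transforms-cons : ∀ b {σ X} → Transforms (λ _ → cons (suc (toℕ b))) (σ ⌢ X) ((b ∷ σ) ⌢ X)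
  transforms-cons b {σ} {X} = (λ {_} {τ} → cons⊑ {τ}) , λ K → K , λ {_} {τ} _ → cons-agree {τ}
    where
    cons⊑ : ∀ {τ} → dig τ ⊑ toℕ ∘ (σ ⌢ X) → dig (cons (suc (toℕ b)) τ) ⊑ toℕ ∘ ((b ∷ σ) ⌢ X)
    cons⊑ {τ} τ⊑ zero    eq = suc-lo-bit b (trans (sym (dig-cons-zero (suc (toℕ b)) τ)) eq)
    cons⊑ {τ} τ⊑ (suc i) eq = τ⊑ i (trans (sym (dig-cons-suc (suc (toℕ b)) τ i)) eq)
    cons-agree : ∀ {τ K} → Agree K (dig τ) (toℕ ∘ (σ ⌢ X)) →
                 Agree K (dig (cons (suc (toℕ b)) τ)) (toℕ ∘ ((b ∷ σ) ⌢ X))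
    cons-agree {τ} agree {zero}  lt = trans (dig-cons-zero (suc (toℕ b)) τ) (lo-bit b)
    cons-agree {τ} agree {suc i} lt = trans (dig-cons-suc (suc (toℕ b)) τ i) (agree (<⇒≤ lt))

-- Beyond N the string may leave X, as a leaf above an initial segment of X must when X is a path;
-- hence `Agree` and not `⊑`.
Agree-prefix : ∀ X N {σ ρ} τ → σ ≡ applyUpTo X N ++ ρ → Agree N (dig (prefix σ τ)) (toℕ ∘ X)
Agree-prefix X (suc N) {b ∷ σ} τ refl {zero}  lt =
  trans (dig-cons-zero (suc (toℕ b)) (prefix σ τ)) (lo-bit b)
Agree-prefix X (suc N) {b ∷ σ} τ refl {suc i} lt =
  trans (dig-cons-suc (suc (toℕ b)) (prefix σ τ) i) (Agree-prefix (X ∘ suc) N τ refl (s<s⁻¹ lt))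

module Image (Φ : Functional) where

  -- Storing values as digits reduces them modulo 4. This is harmless where it matters: if τ is part
  -- of an X with Φ(X ⊕ g) in Cantor space, the shifted values are 0, 1 or 2.
  image : Baire → ℕ → ℕ → ℕ
  image g s τ = build (λ i → eval Φ (τ ⊕ₚ g) s (i ∷ [])) (upTo s)

  imageᵗ : Total n → Total n → Total n
  imageᵗ s t = foldrᵗ (consᵗ (evalᵗ Φ ⟨ s ↑ 2 ∷ᵗ t ↑ 2 ∷ᵗ var 0F ∷ᵗ []ᵗ ⟩) (var 1F)) (constᵗ 0) s

  transforms-image : ∀ {g X Y} → Φ [ (toℕ ∘ X) ⊕ g ]≈ (toℕ ∘ Y) → Transforms (image g) X Y
  transforms-image {g} {X} {Y} Φ⇓ = (λ {s} {τ} → image⊑ {s} {τ}) , image-agree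
    where
    image⊑ : ∀ {s τ} → dig τ ⊑ toℕ ∘ X → dig (image g s τ) ⊑ toℕ ∘ Y
    image⊑ {s} {τ} τ⊑X i eq with i <? s
    ... | no i≮s with () ← trans (sym eq) (dig-build-≥ (λ i → eval Φ (τ ⊕ₚ g) s (i ∷ [])) s id (≮⇒≥ i≮s))
    ... | yes i<s
      with eval Φ (τ ⊕ₚ g) s (i ∷ []) in v≡
         | trans (sym eq) (dig-build-< (λ i → eval Φ (τ ⊕ₚ g) s (i ∷ [])) s id i<s)
    ...   | suc v | eq′ with refl ← ⇓-functional (eval-sound (⊕ₚ-⊑ {τ} {g = g} τ⊑X) Φ (i ∷ []) v≡) (Φ⇓ i) =
      suc-lo-bit (Y i) (sym eq′)
    image-agree : ∀ K → ∃[ M ] ∀ {s τ} → M ≤ s → Agree M (dig τ) (toℕ ∘ X) →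
                  Agree K (dig (image g s τ)) (toℕ ∘ Y)
    image-agree K =
      let N , evals = eventually-∀< K λ {i} _ → eval-complete (Φ⇓ i) in
      -- Only s positions are written, so s ≥ K is required besides the bound N for convergence.
      K ⊔ N , λ {s} {τ} le agree {i} i<K → begin
        dig (image g s τ) i
          ≡⟨ dig-build-< (λ i → eval Φ (τ ⊕ₚ g) s (i ∷ [])) s id (<-≤-trans i<K (m⊔n≤o⇒m≤o K N le)) ⟩
        lo (eval Φ (τ ⊕ₚ g) s (i ∷ []))
          ≡⟨ cong lo (evals (m⊔n≤o⇒n≤o K N le)
               (⊕ₚ-Agree {τ = τ} (Agree-≤ (m≤n⊔m K N) agree)) i<K) ⟩
        lo (suc (toℕ (Y i)))
          ≡⟨ lo-bit (Y i) ⟩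
        suc (toℕ (Y i)) ∎
      where open ≡-Reasoning

  -- A word acts on partial functions from the right: the digits 1 and 2
  -- prepend a bit, the digit 3 applies Φ.

  runDigit : Baire → ℕ → ℕ → ℕ → ℕ
  runDigit g s d τ = onDigit d τ (cons 1 τ) (cons 2 τ) (image g s τ)

  run : Baire → ℕ → ℕ → ℕ → ℕ
  run g w s τ = foldr (runDigit g s) τ (digits w)

  runᵗ : Total n → Total n → Total n → Total n
  runᵗ w s t = digitFoldᵗ
    (onDigitᵗ (var 0F) (var 1F) (consᵗ (constᵗ 1) (var 1F)) (consᵗ (constᵗ 2) (var 1F))
              (imageᵗ (s ↑ 2) (var 1F)))
    t w

  -- Composes w with F_ρ on the inside, where ρ is `string z`: as the fold starts at the right end,
  -- first ρ is prepended, then Φ is applied, then w acts.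
  append : ℕ → ℕ → ℕ
  append w z = fromDigits (digits w ++ 3 ∷ bitDigits (string z))

  appendᵗ : Total n → Total n → Total n
  appendᵗ w z = reshape
    (digitFoldᵗ (consᵗ (var 0F) (var 1F)) (consᵗ (constᵗ 3) (prefixᵗ z (constᵗ 0))) w)
    (λ g xs → append (fun w g xs) (fun z g xs))
    (λ g xs → let σ = string (fun z g xs) ; ds = digits (fun w g xs) in sym (begin
      fromDigits (ds ++ 3 ∷ bitDigits σ)           ≡⟨ foldr-++ cons 0 ds (3 ∷ bitDigits σ) ⟩
      foldr cons (fromDigits (3 ∷ bitDigits σ)) ds ≡⟨ cong (λ x → foldr cons (cons 3 x) ds)
                                                           (foldr-map cons (suc ∘ toℕ) 0 σ) ⟩
      foldr cons (cons 3 (prefix σ 0)) ds          ∎))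
    where open ≡-Reasoning

  run-append : ∀ g w z s τ → run g w s (image g s (prefix (string z) τ)) ≡ run g (append w z) s τ
  run-append g w z s τ = sym (begin
    run g (append w z) s τ
      ≡⟨ foldr-digits-fromDigits (runDigit g s) (λ _ → refl) τ (digits w ++ 3 ∷ bitDigits (string z)) ⟩
    foldr (runDigit g s ∘ lo) τ (digits w ++ 3 ∷ bitDigits (string z))
      ≡⟨ foldr-++ (runDigit g s ∘ lo) τ (digits w) (3 ∷ bitDigits (string z)) ⟩
    foldr (runDigit g s ∘ lo) (image g s (foldr (runDigit g s ∘ lo) τ (bitDigits (string z)))) (digits w)
      ≡⟨ foldr-lo-digits (runDigit g s) _ w ⟩
    run g w s (image g s (foldr (runDigit g s ∘ lo) τ (bitDigits (string z))))
      ≡⟨ cong (λ x → run g w s (image g s x)) (run-bitDigits (string z)) ⟩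
    run g w s (image g s (prefix (string z) τ)) ∎)
    where
    open ≡-Reasoning
    run-bitDigits : ∀ σ → foldr (runDigit g s ∘ lo) τ (bitDigits σ) ≡ prefix σ τ
    run-bitDigits []       = refl
    run-bitDigits (0F ∷ σ) = cong (cons 1) (run-bitDigits σ)
    run-bitDigits (1F ∷ σ) = cong (cons 2) (run-bitDigits σ)

-- Composition along leaves

least-zero : ∀ (f : ℕ → ℕ) k → f k ≡ 0 →
             ∃[ x ] f x ≡ 0 × (∀ {w} → w < x → ∃[ v ] f w ≡ suc v)
least-zero f zero    eq = 0 , eq , λ ()
least-zero f (suc k) eq with f 0 in eq₀
... | zero  = 0 , eq₀ , λ ()
... | suc v =
  let x , fx≡0 , below = least-zero (f ∘ suc) k eq in
  suc x , fx≡0 , λ { {zero} _ → v , eq₀ ; {suc w} lt → below (s<s⁻¹ lt) }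

-- Every proper extension passes through one of the two children. Being a leaf is thus decided by
-- three membership tests, which makes the search for leaves computable.
leaf-intro : ∀ {T σ} → IsTree T → σ ∈ T → σ ++ 0F ∷ [] ∉ T → σ ++ 1F ∷ [] ∉ T → Leaf T σ
leaf-intro {T} {σ} tree σ∈T σ0∉T σ1∉T = σ∈T , λ
  { []       _ → refl
  ; (0F ∷ τ) p → ⊥-elim (σ0∉T (tree (σ ++ 0F ∷ []) τ (subst (_∈ T) (sym (++-assoc σ (0F ∷ []) τ)) p)))
  ; (1F ∷ τ) p → ⊥-elim (σ1∉T (tree (σ ++ 1F ∷ []) τ (subst (_∈ T) (sym (++-assoc σ (1F ∷ []) τ)) p))) }

leaf-maximal : ∀ T σ b → Leaf T σ → σ ++ b ∷ [] ∉ T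
leaf-maximal T σ b (_ , maximal) p with () ← maximal (b ∷ []) p

-- 0 means success, as μ searches for zeros.

leafTest : ℕ → ℕ → ℕ → ℕ → ℕ
leafTest x x₀ x₁ y = if0 x 1 (if0 x₀ (if0 x₁ (1 ∸ y) 1) 1)

leafTest-complete : ∀ {x x₀ x₁ y v} → x ≡ 1 → x₀ ≡ 0 → x₁ ≡ 0 → y ≡ suc v → leafTest x x₀ x₁ y ≡ 0
leafTest-complete {v = v} refl refl refl refl = 0∸n≡0 v

leafTest-sound : ∀ x x₀ x₁ y → leafTest x x₀ x₁ y ≡ 0 →
                 (∃[ u ] x ≡ suc u) × x₀ ≡ 0 × x₁ ≡ 0 × (∃[ v ] y ≡ suc v)
leafTest-sound (suc u) zero zero (suc v) eq = (u , refl) , refl , refl , (v , refl)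

module Search {T : Pred String 0ℓ} (tree : IsTree T) (T-computable : Computable T) (Φ : Functional) where

  open Membership T-computable
  open Image Φ

  -- z is both the candidate for the next leaf and the bound on searches.

  output : Baire → ℕ → ℕ → ℕ → ℕ
  output g z N w = dig (run g w z (image g z (prefix (string z) 0))) N

  outputᵗ : Total n → Total n → Total n → Total n
  outputᵗ z N w = digᵗ (runᵗ w z (imageᵗ z (prefixᵗ z (constᵗ 0)))) N

  check : Baire → ℕ → ℕ → ℕ → ℕ
  check g z N w =
    leafTest (χ (string z ++ [])) (χ (string z ++ 0F ∷ [])) (χ (string z ++ 1F ∷ [])) (output g z N w)

  checkᵗ : Total 3
  checkᵗ = if0ᵗ (χᵗ (var 0F) []) (constᵗ 1)
    (if0ᵗ (χᵗ (var 0F) (0F ∷ []))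
      (if0ᵗ (χᵗ (var 0F) (1F ∷ [])) (constᵗ 1 ∸ᵗ outputᵗ (var 0F) (var 1F) (var 2F)) (constᵗ 1))
      (constᵗ 1))

  check-complete : ∀ g z N w {v} → Leaf T (string z) → output g z N w ≡ suc v → check g z N w ≡ 0
  check-complete g z N w leaf = leafTest-complete
    (∈⇒χ≡1 (subst (_∈ T) (sym (++-identityʳ (string z))) (proj₁ leaf)))
    (∉⇒χ≡0 (leaf-maximal T (string z) 0F leaf)) (∉⇒χ≡0 (leaf-maximal T (string z) 1F leaf))

  check-sound : ∀ g z N w → check g z N w ≡ 0 →
                Leaf T (string z) × ∃[ v ] output g z N w ≡ suc v
  check-sound g z N w eq =
    let (u , x≡) , x₀≡ , x₁≡ , out = leafTest-sound _ _ _ (output g z N w) eq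
    in leaf-intro tree (subst (_∈ T) (++-identityʳ (string z)) (χ≡suc⇒∈ (string z ++ []) x≡))
         (χ≡0⇒∉ (string z ++ 0F ∷ []) x₀≡) (χ≡0⇒∉ (string z ++ 1F ∷ []) x₁≡) , out

  searchᶜ : Code 1 2
  searchᶜ = μ (code checkᵗ)

  extendᵗ : Total 2
  extendᵗ = appendᵗ (var 0F) (var 1F)

  resultᵗ : Total 3
  resultᵗ = predᵗ (outputᵗ (var 2F) (var 0F) (var 1F))

  -- The start 0 is the empty word, which acts as the identity; each step searches for the next leaf
  -- and puts its F_ρ innermost.
  wordᶜ : Code 1 1
  wordᶜ = primrec zeroᶜ (comp (code extendᵗ) (proj 1F ∷ searchᶜ ∷ []))

  -- The search is repeated to read off the bit that made it succeed. The elements `X₀` and `Y₀`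
  -- occur only in the verification below, so g is the only oracle.
  limitᶜ : Functional
  limitᶜ = comp (code resultᵗ) (proj 0F ∷ wordᶜ ∷ comp searchᶜ (proj 0F ∷ wordᶜ ∷ []) ∷ [])

  module Limit {P Q : Pred Cantor 0ℓ} (g : Baire)
    (Φ-maps : ∀ {X} → X ∈ Q ⌢[ T ] P → ∃[ Y ] Y ∈ P × Φ [ (toℕ ∘ X) ⊕ g ]≈ (toℕ ∘ Y))
    {X₀ : Cantor} (X₀∈Q : X₀ ∈ Q) (X₀∈T : X₀ ∈ Paths T) {Y₀ : Cantor} (Y₀∈P : Y₀ ∈ P)
    (leaf-above : ∀ {σ} → σ ∈ T → ∃[ τ ] Leaf T (σ ++ τ))
    where

    -- The word w stands for F_ρ₀ ∘ … ∘ F_ρₙ₋₁. That every value of it has the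
    -- first N bits already computed makes these bits compatible with P.

    Factors : ℕ → ℕ → Cantor → Set
    Factors N w Y = ∃[ Z ] Z ∈ P × Transforms (run g w) Y Z ×
                    (∀ {n} → n < N → g ∷ [] ⊢ limitᶜ · n ∷ [] ⇓ toℕ (Z n))

    record Stage (N : ℕ) : Set where
      field
        word    : ℕ
        word⇓   : g ∷ [] ⊢ wordᶜ · N ∷ [] ⇓ word
        factors : ∀ {Y} → Y ∈ P → Factors N word Y

    open Stage

    -- The composite takes `X₀` to the total Z, so finitely many bits of `X₀` suffice for the bit at
    -- N. The one M bounds both these bits and the search.
    output-defined : ∀ N w {Y Z} → Φ [ (toℕ ∘ X₀) ⊕ g ]≈ (toℕ ∘ Y) → Transforms (run g w) Y Z →
      ∃[ M ] ∀ z → M ≤ z → Agree M (dig (prefix (string z) 0)) (toℕ ∘ X₀) →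
             output g z N w ≡ suc (toℕ (Z N))
    output-defined N w Φ⇓ run-trans =
      let M , agree = proj₂ (transforms-∘ (transforms-image Φ⇓) run-trans) (suc N)
      in M , λ z M≤z agree₀ → agree {z} {prefix (string z) 0} M≤z (λ {i} → agree₀ {i}) {N} ≤-refl

    solution : ∀ {N} (S : Stage N) → ∃[ z ] check g z N (word S) ≡ 0
    solution {N} S =
      let Y , Y∈P , Φ⇓ = Φ-maps (inj₁ X₀∈Q)
          Z , Z∈P , run-trans , _ = factors S Y∈P
          M , out≡ = output-defined N (word S) Φ⇓ run-trans
          ρ , leaf = leaf-above (X₀∈T M)
          -- The leaf may have too small a code to serve as search bound, so it is padded up to M.
          z , M≤z , string≡ = pad-exists M (applyUpTo X₀ M ++ ρ)
      in z , check-complete g z N (word S) (subst (Leaf T) (sym string≡) leaf)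
               (out≡ z M≤z (Agree-prefix X₀ M 0 string≡))

    search⇓ : ∀ {N} (S : Stage N) →
              ∃[ z ] check g z N (word S) ≡ 0 × g ∷ [] ⊢ searchᶜ · N ∷ word S ∷ [] ⇓ z
    search⇓ {N} S =
      let k , check-k = solution S
          z , check-z , below = least-zero (λ z → check g z N (word S)) k check-k
      in z , check-z , μ⇓ (check⇓ check-z) (λ w<z → proj₁ (below w<z) , check⇓ (proj₂ (below w<z)))
      where
      check⇓ : ∀ {z y} → check g z N (word S) ≡ y → g ∷ [] ⊢ code checkᵗ · z ∷ N ∷ word S ∷ [] ⇓ y
      check⇓ {z} refl = code⇓ checkᵗ g (z ∷ N ∷ word S ∷ [])

    initial : Stage 0
    initial = record
      { word    = 0
      ; word⇓   = base⇓ zero⇓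
      ; factors = λ {Y} Y∈P → Y , Y∈P , transforms-id , λ () }

    next : ∀ {N} → Stage N → Stage (suc N)
    next {N} S =
      let z , check≡0 , z⇓ = search⇓ S
          leaf , v , output≡ = check-sound g z N (word S) check≡0
      in record
        { word    = append (word S) z
        ; word⇓   = step⇓ (word⇓ S) (comp⇓ (proj⇓ ∷ z⇓ ∷ []) (code⇓ extendᵗ g (word S ∷ z ∷ [])))
        ; factors = extend z z⇓ leaf v output≡ }
      where
      module _ z (z⇓ : g ∷ [] ⊢ searchᶜ · N ∷ word S ∷ [] ⇓ z) (leaf : Leaf T (string z))
               v (output≡ : output g z N (word S) ≡ suc v) where

        limit⇓ : g ∷ [] ⊢ limitᶜ · N ∷ [] ⇓ v
        limit⇓ = subst (g ∷ [] ⊢ limitᶜ · N ∷ [] ⇓_) (cong pred output≡)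
          (comp⇓ (proj⇓ ∷ word⇓ S ∷ comp⇓ (proj⇓ ∷ word⇓ S ∷ []) z⇓ ∷ [])
                 (code⇓ resultᵗ g (N ∷ word S ∷ z ∷ [])))

        extend : ∀ {Y} → Y ∈ P → Factors (suc N) (append (word S) z) Y
        extend {Y} Y∈P =
          let X = string z ⌢ Y
              Y₁ , Y₁∈P , Φ⇓ = Φ-maps (inj₂ (string z , leaf , Y , Y∈P , λ _ → refl))
              Z , Z∈P , run-trans , limit⇓< = factors S Y₁∈P
              Y-Z = transforms-∘ (transforms-∘ (transforms-prefix (string z)) (transforms-image Φ⇓)) run-trans
              v≡ : toℕ (Z N) ≡ v
              -- The code 0 is the empty partial function, which is part of every Y. So the bit v
              -- found by the search is the bit at N of the value at any Y in P.
              v≡ = proj₁ Y-Z {z} {0} (λ i eq → ⊥-elim (0≢1+n (trans (sym (dig-zero i)) eq))) N output≡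
              limit⇓≤ : ∀ {n} → n < suc N → g ∷ [] ⊢ limitᶜ · n ∷ [] ⇓ toℕ (Z n)
              limit⇓≤ n<1+N = [ limit⇓< , (λ { refl → subst (g ∷ [] ⊢ limitᶜ · N ∷ [] ⇓_) (sym v≡) limit⇓ }) ]′
                                (m<1+n⇒m<n∨m≡n n<1+N)
          in Z , Z∈P , transforms-cong (run-append g (word S) z) Y-Z , limit⇓≤

    stage : ∀ N → Stage N
    stage zero    = initial
    stage (suc N) = next (stage N)

    -- The composites of all stages, applied to `Y₀`, give elements Z N of P whose first N bits are
    -- those of the limit; closedness of P does the rest.
    limit : IsΠ⁰₁ P → ∃[ X ] X ∈ P × limitᶜ [ g ]≈ (toℕ ∘ X)
    limit P-Π⁰₁ = X , Π⁰₁-closed P-Π⁰₁ (λ N → Z N , Z∈P N , X≡Z) , X⇓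
      where
      Z : ℕ → Cantor
      Z N = proj₁ (factors (stage N) Y₀∈P)
      Z∈P : ∀ N → Z N ∈ P
      Z∈P N = proj₁ (proj₂ (factors (stage N) Y₀∈P))
      Z⇓ : ∀ {n N} → n < N → g ∷ [] ⊢ limitᶜ · n ∷ [] ⇓ toℕ (Z N n)
      Z⇓ {N = N} = proj₂ (proj₂ (proj₂ (factors (stage N) Y₀∈P)))
      -- Stage n + 1 is the first at which bit n is certified.
      X : Cantor
      X n = Z (suc n) n
      X⇓ : limitᶜ [ g ]≈ (toℕ ∘ X)
      X⇓ n = Z⇓ (n<1+n n)
      X≡Z : ∀ {N n} → n < N → X n ≡ Z N n
      X≡Z {N} {n} n<N = toℕ-injective (⇓-functional (X⇓ n) (Z⇓ n<N))

-- Trees with a leafless node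

applyUpTo-+ : ∀ (f : ℕ → A) k l → applyUpTo f (k + l) ≡ applyUpTo f k ++ applyUpTo (f ∘ (k +_)) l
applyUpTo-+ f zero    l = refl
applyUpTo-+ f (suc k) l = cong (f 0 ∷_) (applyUpTo-+ (f ∘ suc) k l)

applyUpTo-⌢ : ∀ σ X n → applyUpTo (σ ⌢ X) (List.length σ + n) ≡ σ ++ applyUpTo X n
applyUpTo-⌢ []      X n = refl
applyUpTo-⌢ (b ∷ σ) X n = cong (b ∷_) (applyUpTo-⌢ σ X n)

string-∷ʳ : ∀ w b → string (fromDigits (digits w ++ suc (toℕ b) ∷ [])) ≡ string w ++ b ∷ []
string-∷ʳ w b = begin
  string (fromDigits (digits w ++ suc (toℕ b) ∷ []))
    ≡⟨ string-fromDigits (digits w ++ suc (toℕ b) ∷ []) ⟩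
  foldr (onBit _∷_ ∘ lo) [] (digits w ++ suc (toℕ b) ∷ [])
    ≡⟨ foldr-++ (onBit _∷_ ∘ lo) [] (digits w) (suc (toℕ b) ∷ []) ⟩
  foldr (onBit _∷_ ∘ lo) (foldr (onBit _∷_ ∘ lo) [] (bitDigits (b ∷ []))) (digits w)
    ≡⟨ cong (λ σ → foldr (onBit _∷_ ∘ lo) σ (digits w)) (bits-bitDigits (b ∷ [])) ⟩
  foldr (onBit _∷_ ∘ lo) (b ∷ []) (digits w)
    ≡⟨ foldr-lo-digits (onBit _∷_) (b ∷ []) w ⟩
  foldr (onBit _∷_) (b ∷ []) (digits w)
    ≡⟨ foldr-onBit _∷_ (b ∷ []) (digits w) ⟩
  foldr _∷_ (b ∷ []) (string w)
    ≡⟨ ++-is-foldr (string w) (b ∷ []) ⟨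
  string w ++ b ∷ [] ∎
  where open ≡-Reasoning

module Leafless {T : Pred String 0ℓ} (tree : IsTree T) (T-computable : Computable T)
  (σ₀ : String) (σ₀∈T : σ₀ ∈ T) (no-leaf : ∀ τ → ¬ Leaf T (σ₀ ++ τ)) where

  open Membership T-computable

  nextBit : String → Fin 2
  nextBit σ = if0 (χ (σ ++ 0F ∷ [])) 1F 0F

  nextBit∈T : ∀ σ → σ ∈ T → ¬ Leaf T σ → σ ++ nextBit σ ∷ [] ∈ T
  nextBit∈T σ σ∈T ¬leaf with χ (σ ++ 0F ∷ []) in eq₀
  ... | suc _ = χ≡suc⇒∈ (σ ++ 0F ∷ []) eq₀
  ... | zero with χ (σ ++ 1F ∷ []) in eq₁
  ...   | suc _ = χ≡suc⇒∈ (σ ++ 1F ∷ []) eq₁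
  ...   | zero  = ⊥-elim (¬leaf (leaf-intro tree σ∈T
                    (χ≡0⇒∉ (σ ++ 0F ∷ []) eq₀) (χ≡0⇒∉ (σ ++ 1F ∷ []) eq₁)))

  segment : ℕ → String
  tail    : Cantor

  segment zero    = σ₀
  segment (suc n) = segment n ++ tail n ∷ []

  tail n = nextBit (segment n)

  path : Cantor
  path = σ₀ ⌢ tail

  segment≡ : ∀ n → segment n ≡ σ₀ ++ applyUpTo tail n
  segment≡ zero    = sym (++-identityʳ σ₀)
  segment≡ (suc n) = begin
    segment n ++ tail n ∷ []                  ≡⟨ cong (_++ tail n ∷ []) (segment≡ n) ⟩
    (σ₀ ++ applyUpTo tail n) ++ tail n ∷ []   ≡⟨ ++-assoc σ₀ (applyUpTo tail n) (tail n ∷ []) ⟩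
    σ₀ ++ applyUpTo tail n ++ tail n ∷ []     ≡⟨ cong (σ₀ ++_) (applyUpTo-∷ʳ tail n) ⟩
    σ₀ ++ applyUpTo tail (suc n)              ∎
    where open ≡-Reasoning

  segment∈T : ∀ n → segment n ∈ T
  segment∈T zero    = σ₀∈T
  segment∈T (suc n) = nextBit∈T (segment n) (segment∈T n)
    (subst (¬_ ∘ Leaf T) (sym (segment≡ n)) (no-leaf (applyUpTo tail n)))

  -- `segment n` has n bits beyond `σ₀`, so it extends the first n bits of the path, and T is closed
  -- under initial segments.
  path∈T : path ∈ Paths T
  path∈T n = tree (applyUpTo path n) _ (subst (_∈ T) (begin
    segment n                                         ≡⟨ segment≡ n ⟩
    σ₀ ++ applyUpTo tail n                            ≡⟨ applyUpTo-⌢ σ₀ tail n ⟨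
    applyUpTo path (List.length σ₀ + n)               ≡⟨ cong (applyUpTo path) (+-comm (List.length σ₀) n) ⟩
    applyUpTo path (n + List.length σ₀)               ≡⟨ applyUpTo-+ path n (List.length σ₀) ⟩
    applyUpTo path n ++ applyUpTo (path ∘ (n +_)) (List.length σ₀) ∎) (segment∈T n))
    where open ≡-Reasoning

  nextBitᵗ : Total n → Total n
  nextBitᵗ w = reshape (if0ᵗ (χᵗ w (0F ∷ [])) (constᵗ 1) (constᵗ 0))
    (λ g xs → toℕ (nextBit (string (fun w g xs))))
    (λ g xs → toℕ-if0 (χ (string (fun w g xs) ++ 0F ∷ [])))
    where
    toℕ-if0 : ∀ x → if0 x 1 0 ≡ toℕ (if0 x 1F 0F)
    toℕ-if0 zero    = refl
    toℕ-if0 (suc _) = refl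

  grow : ℕ → ℕ
  grow w = fromDigits (digits w ++ suc (toℕ (nextBit (string w))) ∷ [])

  growᵗ : Total n → Total n
  growᵗ w = reshape (digitFoldᵗ (consᵗ (var 0F) (var 1F)) (consᵗ (sucᵗ (nextBitᵗ w)) (constᵗ 0)) w)
    (λ g xs → grow (fun w g xs))
    (λ g xs → sym (foldr-++ cons 0 (digits (fun w g xs)) _))

  string-grow : ∀ n → string (natrec (pad 0 σ₀) (λ _ → grow) n) ≡ segment n
  string-grow zero    = string-pad 0 σ₀
  string-grow (suc n) = trans (string-∷ʳ w (nextBit (string w)))
                              (cong (λ σ → σ ++ nextBit σ ∷ []) (string-grow n))
    where w = natrec (pad 0 σ₀) (λ _ → grow) n

  tailᵗ : Total n → Total n
  tailᵗ t = reshape (nextBitᵗ (recᵗ (constᵗ (pad 0 σ₀)) (growᵗ (var 1F)) t))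
    (λ g xs → toℕ (tail (fun t g xs)))
    (λ g xs → cong (toℕ ∘ nextBit) (string-grow (fun t g xs)))

  -- The finite string is built into the code bit by bit. Primitive recursion serves as a case
  -- distinction on the position, with `var 0F` as its predecessor.
  ⌢tailᵗ : String → Total n → Total n
  ⌢tailᵗ []      t = tailᵗ t
  ⌢tailᵗ (b ∷ σ) t = recᵗ (constᵗ (toℕ b)) (⌢tailᵗ σ (var 0F)) t

  fun-⌢tailᵗ : ∀ σ (t : Total n) g xs → fun (⌢tailᵗ σ t) g xs ≡ toℕ ((σ ⌢ tail) (fun t g xs))
  fun-⌢tailᵗ []      t g xs = refl
  fun-⌢tailᵗ (b ∷ σ) t g xs with fun t g xs
  ... | zero  = refl
  ... | suc x = fun-⌢tailᵗ σ (var 0F) g (x ∷ _ ∷ xs)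

  pathᵗ : Total n → Total n
  pathᵗ t = reshape (⌢tailᵗ σ₀ t) (λ g xs → toℕ (path (fun t g xs))) (fun-⌢tailᵗ σ₀ t)

  path⊕ᵗ : Total 1
  path⊕ᵗ = reshape (if0ᵗ (parᵗ (var 0F)) (pathᵗ (halfᵗ (var 0F))) (oracleᵗ (halfᵗ (var 0F))))
    (λ g xs → ((toℕ ∘ path) ⊕ g) (Vec.lookup xs 0F))
    (λ g xs → sym (⊕-par (toℕ ∘ path) g (Vec.lookup xs 0F)))

  substitute : Functional → Functional
  substitute Φ = sub (λ _ → code path⊕ᵗ) Φ

  substitute⇓ : ∀ {Φ g f} → Φ [ (toℕ ∘ path) ⊕ g ]≈ f → substitute Φ [ g ]≈ f
  substitute⇓ {g = g} Φ⇓ n = sub⇓ (λ { 0F x → code⇓ path⊕ᵗ g (x ∷ []) }) (Φ⇓ n)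

-- The two cases combined

theorem26 : ∀ {ℓ : Level} → ExcludedMiddle 0ℓ →
    (P Q : Pred Cantor 0ℓ) → IsΠ⁰₁ P → IsΠ⁰₁ Q →
    Satisfiable P → Satisfiable Q →
    (T : Pred String 0ℓ) → IsCorrespondingTree T Q →
    (R : Pred Baire ℓ) →
    ⌊ P ⌋ ≤¹₁ ⌊ Q ⌢[ T ] P ⌋ ⊗ R → ⌊ P ⌋ ≤¹₁ R
theorem26 em P Q P-Π⁰₁ _ (Y₀ , Y₀∈P) (X₀ , X₀∈Q) T T-tree R (Φ , Φ-maps) = decide em
  where
  open IsCorrespondingTree T-tree
  maps : ∀ {g} → g ∈ R → ∀ {X} → X ∈ Q ⌢[ T ] P →
         ∃[ Y ] Y ∈ P × Φ [ (toℕ ∘ X) ⊕ g ]≈ (toℕ ∘ Y)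
  maps {g} g∈R {X} X∈ =
    let f , (Y , Y∈P , f≗Y) , Φ⇓ = Φ-maps (toℕ ∘ X , g , (X , X∈ , λ _ → refl) , g∈R , λ _ → refl)
    in Y , Y∈P , λ n → subst (((toℕ ∘ X) ⊕ g ∷ []) ⊢ Φ · n ∷ [] ⇓_) (f≗Y n) (Φ⇓ n)
  -- The case distinction concerns T alone and precedes the choice of g, so in either case one
  -- functional serves all of R.
  decide : Dec (∃[ σ ] σ ∈ T × (∀ τ → ¬ Leaf T (σ ++ τ))) → ⌊ P ⌋ ≤¹₁ R
  decide (yes (σ , σ∈T , no-leaf)) = substitute Φ , λ {g} g∈R →
    let Y , Y∈P , Φ⇓ = maps g∈R (inj₁ (proj₁ paths path∈T))
    in toℕ ∘ Y , (Y , Y∈P , λ _ → refl) , substitute⇓ {Φ} Φ⇓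
    where open Leafless isTree computable σ σ∈T no-leaf
  decide (no ¬leafless) = limitᶜ , λ {g} g∈R →
    let X , X∈P , X⇓ = Limit.limit g (maps g∈R) X₀∈Q (proj₂ paths X₀∈Q) Y₀∈P leaf-above P-Π⁰₁
    in toℕ ∘ X , (X , X∈P , λ _ → refl) , X⇓
    where
    open Search isTree computable Φ
    leaf-above : ∀ {σ} → σ ∈ T → ∃[ τ ] Leaf T (σ ++ τ)
    leaf-above {σ} σ∈T = decidable-stable em λ ¬leaf →
      ¬leafless (σ , σ∈T , λ τ leaf → ¬leaf (τ , leaf))
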